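{- Let $k \in \mathbb{N}$. There exists a constant $c_k$ such that if $m,n \in \mathbb{N}$ and $A$ is an $m \times n$ $(0,1)$-matrix satisfying (i) at least $c_k n$ of the entries of $A$ are $1$, and (ii) the rows of $A$ are pairwise different, then $A$ contains some member of each class of $\mathcal{M}(k)$.
   Context: For $k \times k$ matrices $K$ and $L$, $(K,L)$ denotes the $k \times 2k$ matrix obtained by putting $K$ in front of (to the left of) $L$. Two matrices $C$ and $D$ are equivalent, $C \sim D$, if $D$ is obtained from $C$ by permuting its rows. $\mathcal{M}(k)$ denotes the set of equivalence classes, with respect to $\sim$, in the family of all matrices $(K,L)$ where $K$ and $L$ are $k \times k$ permutation matrices. (Every such matrix is equivalent to a unique matrix $(I,M)$ with $I$ the $k\times k$ identity matrix and $M$ a permutation matrix, so $|\mathcal{M}(k)| = k!$.) For $(0,1)$-matrices $P$ and $Q$, $Q$ is a sub-matrix of $P$ if it is obtained from $P$ by deleting rows and columns (keeping the order of the remaining ones). $P$ contains $Q = (q_{ij})$ if there is a sub-matrix $R = (r_{ij})$ of $P$, of the same size as $Q$, with $r_{ij} = 1$ whenever $q_{ij} = 1$. -}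

module Defs where

open import Algebra.Properties.CommutativeMonoid.Sum using (sum)
open import Data.Digit using (Bit; 1b)
open import Data.Fin.Base using (Fin; toℕ; _<_)
open import Data.Fin.Permutation using (Permutation′; _⟨$⟩ʳ_; id; flip; _∘ₚ_; inverseʳ)
open import Data.Nat.Base using (ℕ; _+_)
open import Data.Nat.Properties using (+-0-commutativeMonoid)
open import Data.Product.Base using (∃; ∃₂; _×_; _,_)
open import Data.Product using (∃!)
open import Data.Vec.Functional using (Vector; _++_)
open import Function.Base using (_on_)
open import Level using (0ℓ)
open import Relation.Binary.Bundles using (Setoid)
open import Relation.Binary.Core using (Rel; _Preserves_⟶_)
open import Relation.Binary.Structures using (IsEquivalence)
import Relation.Binary.Construct.On as On
open import Relation.Binary.PropositionalEquality
  using (_≡_; _≢_; _≗_; refl; sym; trans; cong)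
open import Relation.Nullary.Negation using (¬_)

-- (0,1)-matrices with m rows and n columns, as vectors of rows.
Matrix : ℕ → ℕ → Set
Matrix m n = Vector (Vector Bit n) m

-- All entries are 0 or 1, so their sum is the number of entries equal to 1.
ones : ∀ {m n} → Matrix m n → ℕ
ones A = ∑ λ i → ∑ λ j → toℕ (A i j)
  where
  ∑ : ∀ {n} → Vector ℕ n → ℕ
  ∑ = sum +-0-commutativeMonoid

-- Rows are functions, so they are compared entrywise (_≗_) rather than by _≡_.
DistinctRows : ∀ {m n} → Matrix m n → Set
DistinctRows A = ∀ i i′ → i ≢ i′ → ¬ (A i ≗ A i′)

IsPermutationMatrix : ∀ {k} → Matrix k k → Set
IsPermutationMatrix P =
  (∀ i → ∃! _≡_ λ j → P i j ≡ 1b) ×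
  (∀ j → ∃! _≡_ λ i → P i j ≡ 1b)

infixr 5 _∥_

_∥_ : ∀ {m n p} → Matrix m n → Matrix m p → Matrix m (n + p)
(K ∥ L) i = K i ++ L i

infix 4 _∼_ _IsSubmatrixOf_ _Contains_

_∼_ : ∀ {m n} → Rel (Matrix m n) 0ℓ
_∼_ {m} C D = ∃ λ (π : Permutation′ m) → ∀ i → D i ≗ C (π ⟨$⟩ʳ i)

∼-isEquivalence : ∀ {m n} → IsEquivalence (_∼_ {m} {n})
∼-isEquivalence = record
  { refl  = id , λ i j → refl
  ; sym   = λ {C} (π , D≗C) → flip π , λ i j →
      sym (trans (D≗C (flip π ⟨$⟩ʳ i) j) (cong (λ l → C l j) (inverseʳ π)))
  ; trans = λ (π , D≗C) (ρ , E≗D) → ρ ∘ₚ π , λ i j →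
      trans (E≗D i j) (D≗C (ρ ⟨$⟩ʳ i) j)
  }

record PermutationPair (k : ℕ) : Set where
  field
    K L   : Matrix k k
    K-isPermutation : IsPermutationMatrix K
    L-isPermutation : IsPermutationMatrix L

  matrix : Matrix k (k + k)
  matrix = K ∥ L

open PermutationPair public using (matrix)

-- The quotient of the family of matrices (K , L) by ∼, as a setoid: the class
-- of an element C consists of the elements D of the family with C ≈ D.
𝓜 : ℕ → Setoid 0ℓ 0ℓ
𝓜 k = record
  { Carrier       = PermutationPair k
  ; _≈_           = _∼_ on matrix
  ; isEquivalence = On.isEquivalence matrix ∼-isEquivalence
  }

-- Deleting rows and columns while keeping the order of the others amounts to
-- selecting the remaining ones by strictly increasing index maps.
_IsSubmatrixOf_ : ∀ {p q m n} → Matrix p q → Matrix m n → Set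
_IsSubmatrixOf_ {p} {q} {m} {n} R P =
  ∃₂ λ (r : Fin p → Fin m) (s : Fin q → Fin n) →
    r Preserves _<_ ⟶ _<_ × s Preserves _<_ ⟶ _<_ ×
    (∀ i j → R i j ≡ P (r i) (s j))

_Contains_ : ∀ {m n p q} → Matrix m n → Matrix p q → Set
_Contains_ {p = p} {q} P Q =
  ∃ λ (R : Matrix p q) → R IsSubmatrixOf P × (∀ i j → Q i j ≡ 1b → R i j ≡ 1b)

{-# OPTIONS --safe #-}

-- Read the rows as distinct subsets of the ordered set of columns.  A pair of
-- columns is heavy if at least k rows contain both, and light otherwise.  The
-- graph of heavy pairs contains no ordered matching of the required shape:
-- distinct rows could be chosen greedily for its k edges.  Cut every row, from
-- left to right, as soon as a light pair shows up in the current piece.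
-- Between cuts all pairs are heavy, so pieces have fewer than 2k elements, and
-- the light pairs at which cuts are made form a graph without the matching,
-- since such pairs from one row span disjoint intervals.  By the Marcus–Tardos
-- theorem that graph has O(n) edges, each of them used by fewer than k rows;
-- this accounts for all rows that are cut.  The uncut rows are distinct
-- cliques of the heavy graph, which is O(1)-degenerate by the Marcus–Tardos
-- theorem again and so has only O(n) cliques.
module Submission where

open import Defs
open import Data.Nat.Base using (ℕ; NonZero; _*_; _≥_)
open import Data.Product.Base using (∃; _×_)
open import Relation.Binary.Bundles using (Setoid)

open import Algebra.Properties.CommutativeMonoid.Sum using () renaming (sum to sumᶜ)
open import Data.Bool.Base using (Bool; true; false; _∧_; _∨_; if_then_else_; not)
open import Data.Bool.ListAction using (any)
import Data.Bool.Properties as Bool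
open import Data.Digit using (Bit; 1b)
open import Data.Empty using (⊥-elim)
open import Data.Fin.Base as Fin using (Fin; zero; suc; toℕ; fromℕ; punchIn; _↑ˡ_; _↑ʳ_)
open import Data.Fin.Permutation using (Permutation′; _⟨$⟩ʳ_; _⟨$⟩ˡ_; inverseˡ; inverseʳ; id; insert; insert-punchIn; lift₀; permutation)
import Data.Fin.Properties as Fin
open import Data.List.Base using (List; []; _∷_; _++_; map; upTo; length; allFin)
open import Data.List.Membership.Propositional using (_∈_)
open import Data.List.Membership.Propositional.Properties using (∈-upTo⁺; ∈-upTo⁻)
open import Data.List.Properties using (map-∘; map-++; map-upTo; map-tabulate; upTo-∷ʳ; length-upTo)
open import Data.List.Relation.Unary.Any using (here; there)
open import Data.Nat.Base hiding (ℕ; NonZero; _*_; _≥_)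
open import Data.Nat.ListAction using (sum)
open import Data.Nat.ListAction.Properties using (sum-++)
open import Data.Nat.Properties
open import Data.Nat.Tactic.RingSolver using (solve-∀)
open import Data.Product.Base using (∃₂; _,_; proj₁; proj₂)
open import Data.Sum.Base using (inj₁; inj₂; [_,_]′)
open import Data.Vec.Base as Vec using (Vec; []; _∷_)
import Data.Vec.Functional as F
import Data.Vec.Properties as Vec
open import Function.Base using (_∘_; flip)
open import Function.Definitions using (Injective)
open import Relation.Binary.Definitions using (DecidableEquality; tri<; tri≈; tri>)
open import Relation.Binary.PropositionalEquality
open import Relation.Nullary using (Dec; yes; no; does; ¬_; contradiction)
open import Relation.Nullary.Decidable using (dec-true; decidable-stable; map′; _×-dec_; _→-dec_)

private variable
  A B : Set
  k m n : ℕ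

-- Truth values as 0 and 1, and search in lists

⟦_⟧ : Bool → ℕ
⟦ true  ⟧ = 1
⟦ false ⟧ = 0

⟦⟧≤1 : ∀ b → ⟦ b ⟧ ≤ 1
⟦⟧≤1 true  = ≤-refl
⟦⟧≤1 false = z≤n

⟦⟧-mono : ∀ {a b} → (a ≡ true → b ≡ true) → ⟦ a ⟧ ≤ ⟦ b ⟧
⟦⟧-mono {false} _ = z≤n
⟦⟧-mono {true}  f rewrite f refl = ≤-refl

does-true : (a? : Dec A) → does a? ≡ true → A
does-true (yes a) _ = a

does-false : (a? : Dec A) → does a? ≡ false → ¬ A
does-false (no ¬a) _ = ¬a

∧-true : ∀ {a b} → a ∧ b ≡ true → a ≡ true × b ≡ true
∧-true {true} {true} _ = refl , refl

any-∃ : ∀ (p : A → Bool) xs → any p xs ≡ true → ∃ λ x → x ∈ xs × p x ≡ true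
any-∃ p (x ∷ xs) eq with p x in px
... | true  = x , here refl , px
... | false = let y , y∈ , py = any-∃ p xs eq in y , there y∈ , py

∃-any : ∀ (p : A → Bool) {xs x} → x ∈ xs → p x ≡ true → any p xs ≡ true
∃-any p (here refl) px rewrite px = refl
∃-any p {y ∷ _} (there x∈) px = trans (cong (p y ∨_) (∃-any p x∈ px)) (Bool.∨-zeroʳ (p y))

-- Finite sums

∑ : List A → (A → ℕ) → ℕ
∑ xs f = sum (map f xs)

∑-mono-∈ : ∀ {f g : A → ℕ} xs → (∀ {x} → x ∈ xs → f x ≤ g x) → ∑ xs f ≤ ∑ xs g
∑-mono-∈ []       _   = z≤n
∑-mono-∈ (x ∷ xs) f≤g = +-mono-≤ (f≤g (here refl)) (∑-mono-∈ xs (f≤g ∘ there))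

∑-mono : ∀ {f g : A → ℕ} xs → (∀ x → f x ≤ g x) → ∑ xs f ≤ ∑ xs g
∑-mono xs f≤g = ∑-mono-∈ xs (λ {x} _ → f≤g x)

∑-cong : ∀ {f g : A → ℕ} xs → (∀ x → f x ≡ g x) → ∑ xs f ≡ ∑ xs g
∑-cong []       _   = refl
∑-cong (x ∷ xs) f≡g = cong₂ _+_ (f≡g x) (∑-cong xs f≡g)

∑-zero : ∀ (xs : List A) → ∑ xs (λ _ → 0) ≡ 0
∑-zero []       = refl
∑-zero (x ∷ xs) = ∑-zero xs

∑-+ : ∀ (f g : A → ℕ) xs → ∑ xs (λ x → f x + g x) ≡ ∑ xs f + ∑ xs g
∑-+ f g []       = refl
∑-+ f g (x ∷ xs) rewrite ∑-+ f g xs = lemma (f x) (g x) (∑ xs f) (∑ xs g)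
  where
  lemma : ∀ a b c d → a + b + (c + d) ≡ a + c + (b + d)
  lemma = solve-∀

∑-*ˡ : ∀ c (f : A → ℕ) xs → ∑ xs (λ x → c * f x) ≡ c * ∑ xs f
∑-*ˡ c f []       = sym (*-zeroʳ c)
∑-*ˡ c f (x ∷ xs) rewrite ∑-*ˡ c f xs = sym (*-distribˡ-+ c (f x) (∑ xs f))

∑-*ʳ : ∀ c (f : A → ℕ) xs → ∑ xs (λ x → f x * c) ≡ ∑ xs f * c
∑-*ʳ c f xs = trans (∑-cong xs (λ x → *-comm (f x) c)) (trans (∑-*ˡ c f xs) (*-comm c (∑ xs f)))

∑-swap : ∀ (f : A → B → ℕ) xs ys →
         ∑ xs (λ x → ∑ ys (f x)) ≡ ∑ ys (λ y → ∑ xs (λ x → f x y))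
∑-swap f []       ys = sym (∑-zero ys)
∑-swap f (x ∷ xs) ys rewrite ∑-swap f xs ys = sym (∑-+ (f x) (λ y → ∑ xs (λ x → f x y)) ys)

∑-≤ : ∀ {f : A → ℕ} {c} xs → (∀ {x} → x ∈ xs → f x ≤ c) → ∑ xs f ≤ length xs * c
∑-≤ []       _   = z≤n
∑-≤ (x ∷ xs) f≤c = +-mono-≤ (f≤c (here refl)) (∑-≤ xs (f≤c ∘ there))

∈⇒≤∑ : ∀ (f : A → ℕ) {xs x} → x ∈ xs → f x ≤ ∑ xs f
∈⇒≤∑ f (here refl)         = m≤m+n _ _
∈⇒≤∑ f {y ∷ _} (there x∈) = ≤-trans (∈⇒≤∑ f x∈) (m≤n+m _ (f y))

∑-map : ∀ (f : B → ℕ) (g : A → B) xs → ∑ (map g xs) f ≡ ∑ xs (f ∘ g)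
∑-map f g xs = cong sum (sym (map-∘ xs))

∑-++ : ∀ (f : A → ℕ) xs ys → ∑ (xs ++ ys) f ≡ ∑ xs f + ∑ ys f
∑-++ f xs ys = trans (cong sum (map-++ f xs ys)) (sum-++ (map f xs) (map f ys))

∑-any : ∀ (p : A → Bool) xs → ⟦ any p xs ⟧ ≤ ∑ xs (⟦_⟧ ∘ p)
∑-any p [] = z≤n
∑-any p (x ∷ xs) with p x
... | true  = s≤s z≤n
... | false = ∑-any p xs

∑-upTo-suc : ∀ (f : ℕ → ℕ) n → ∑ (upTo (suc n)) f ≡ f 0 + ∑ (upTo n) (f ∘ suc)
∑-upTo-suc f n = cong (f 0 +_) (trans (cong (λ xs → ∑ xs f) (sym (map-upTo suc n))) (∑-map f suc (upTo n)))

∑-upTo-∷ʳ : ∀ (f : ℕ → ℕ) n → ∑ (upTo (suc n)) f ≡ ∑ (upTo n) f + f n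
∑-upTo-∷ʳ f n = begin
  ∑ (upTo (suc n)) f     ≡⟨ cong (λ xs → ∑ xs f) (upTo-∷ʳ n) ⟨
  ∑ (upTo n ++ n ∷ []) f ≡⟨ ∑-++ f (upTo n) (n ∷ []) ⟩
  ∑ (upTo n) f + (f n + 0) ≡⟨ cong (∑ (upTo n) f +_) (+-identityʳ (f n)) ⟩
  ∑ (upTo n) f + f n     ∎
  where open ≡-Reasoning

∑-upTo-+ : ∀ (f : ℕ → ℕ) m n → ∑ (upTo (m + n)) f ≡ ∑ (upTo m) f + ∑ (upTo n) (f ∘ (m +_))
∑-upTo-+ f zero    n = refl
∑-upTo-+ f (suc m) n
  rewrite ∑-upTo-suc f (m + n) | ∑-upTo-+ (f ∘ suc) m n | ∑-upTo-suc f m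
  = sym (+-assoc (f 0) _ _)

∑-upTo-≤ : ∀ (f : ℕ → ℕ) → m ≤ n → ∑ (upTo m) f ≤ ∑ (upTo n) f
∑-upTo-≤ {m} {n} f m≤n = begin
  ∑ (upTo m) f                   ≤⟨ m≤m+n _ _ ⟩
  ∑ (upTo m) f + _               ≡⟨ ∑-upTo-+ f m (n ∸ m) ⟨
  ∑ (upTo (m + (n ∸ m))) f       ≡⟨ cong (λ l → ∑ (upTo l) f) (m+[n∸m]≡n m≤n) ⟩
  ∑ (upTo n) f                   ∎
  where open ≤-Reasoning

∑-upTo-* : ∀ (f : ℕ → ℕ) s N →
           ∑ (upTo (N * s)) f ≡ ∑ (upTo N) (λ I → ∑ (upTo s) (λ r → f (I * s + r)))
∑-upTo-* f s zero    = refl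
∑-upTo-* f s (suc N) = begin
  ∑ (upTo (s + N * s)) f
    ≡⟨ ∑-upTo-+ f s (N * s) ⟩
  ∑ (upTo s) f + ∑ (upTo (N * s)) (f ∘ (s +_))
    ≡⟨ cong (∑ (upTo s) f +_) (∑-upTo-* (f ∘ (s +_)) s N) ⟩
  ∑ (upTo s) f + ∑ (upTo N) (λ I → ∑ (upTo s) (λ r → f (s + (I * s + r))))
    ≡⟨ cong (∑ (upTo s) f +_) (∑-cong (upTo N) λ I → ∑-cong (upTo s) λ r →
         cong f (sym (+-assoc s (I * s) r))) ⟩
  ∑ (upTo s) f + ∑ (upTo N) (λ I → ∑ (upTo s) (λ r → f (suc I * s + r)))
    ≡⟨ ∑-upTo-suc (λ I → ∑ (upTo s) (λ r → f (I * s + r))) N ⟨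
  ∑ (upTo (suc N)) (λ I → ∑ (upTo s) (λ r → f (I * s + r))) ∎
  where open ≡-Reasoning

-- If the last value exceeds c, dropping it leaves values whose average is still at most c.
∑-upTo-average : ∀ (f : ℕ → ℕ) c n → ∑ (upTo (suc n)) f ≤ c * suc n → ∃ λ v → v ≤ n × f v ≤ c
∑-upTo-average f c zero h =
  0 , z≤n , subst₂ _≤_ (+-identityʳ (f 0)) (*-identityʳ c) h
∑-upTo-average f c (suc n) h with f (suc n) ≤? c
... | yes f≤c = suc n , ≤-refl , f≤c
... | no  f≰c = let v , v≤n , fv≤c = ∑-upTo-average f c n smaller in v , m≤n⇒m≤1+n v≤n , fv≤c
  where
  open ≤-Reasoning
  smaller : ∑ (upTo (suc n)) f ≤ c * suc n
  smaller = +-cancelʳ-≤ c _ _ (begin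
    ∑ (upTo (suc n)) f + c         ≤⟨ +-monoʳ-≤ _ (<⇒≤ (≰⇒> f≰c)) ⟩
    ∑ (upTo (suc n)) f + f (suc n) ≡⟨ ∑-upTo-∷ʳ f (suc n) ⟨
    ∑ (upTo (suc (suc n))) f       ≤⟨ h ⟩
    c * suc (suc n)                ≡⟨ *-suc c (suc n) ⟩
    c + c * suc n                  ≡⟨ +-comm c _ ⟩
    c * suc n + c                  ∎)

Increasing : (Fin k → ℕ) → Set
Increasing r = ∀ {i j} → i Fin.< j → r i < r j

-- The values are the first k positions satisfying p. This is how lower bounds on counts become
-- increasing rows and columns of a pattern.
enumerate : ∀ (p : ℕ → Bool) n k → k ≤ ∑ (upTo n) (⟦_⟧ ∘ p) →
            ∃ λ (r : Fin k → ℕ) → Increasing r × (∀ i → r i < n × p (r i) ≡ true)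
enumerate p n       zero    _ = (λ ()) , (λ { {()} }) , λ ()
enumerate p (suc n) (suc k) h
  rewrite ∑-upTo-suc (⟦_⟧ ∘ p) n with p 0 in p0
... | false =
  let r , r↑ , r-p = enumerate (p ∘ suc) n (suc k) h
  in  suc ∘ r , s<s ∘ r↑ , λ i → s<s (proj₁ (r-p i)) , proj₂ (r-p i)
... | true =
  let r , r↑ , r-p = enumerate (p ∘ suc) n k (s≤s⁻¹ h)
  in  (λ { zero → 0 ; (suc i) → suc (r i) })
    , (λ { {zero} {suc j} _ → z<s ; {suc i} {suc j} i<j → s<s (r↑ (s<s⁻¹ i<j)) })
    , λ { zero → z<s , p0 ; (suc i) → s<s (proj₁ (r-p i)) , proj₂ (r-p i) }

-- Words

-- Positions past the end read `false`, so a word is a subset of ℕ and indices carry no bounds.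
at : Vec Bool n → ℕ → Bool
at []      _       = false
at (b ∷ w) zero    = b
at (b ∷ w) (suc i) = at w i

at-< : ∀ (w : Vec Bool n) {i} → at w i ≡ true → i < n
at-< (b ∷ w) {zero}  _ = z<s
at-< (b ∷ w) {suc i} h = s<s (at-< w h)

at-tabulate : ∀ (f : ℕ → Bool) {i} → i < n → at (Vec.tabulate {n = n} (f ∘ toℕ)) i ≡ f i
at-tabulate {suc n} f {zero}  _   = refl
at-tabulate {suc n} f {suc i} i<n = at-tabulate (f ∘ suc) (s<s⁻¹ i<n)

words : ∀ n → List (Vec Bool n)
words zero    = [] ∷ []
words (suc n) = map (false ∷_) (words n) ++ map (true ∷_) (words n)

∑-words-suc : ∀ (f : Vec Bool (suc n) → ℕ) →
              ∑ (words (suc n)) f ≡ ∑ (words n) (f ∘ (false ∷_)) + ∑ (words n) (f ∘ (true ∷_))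
∑-words-suc {n} f = trans (∑-++ f (map (false ∷_) (words n)) _)
  (cong₂ _+_ (∑-map f (false ∷_) (words n)) (∑-map f (true ∷_) (words n)))

∑-words-≤ : ∀ (f : Vec Bool n → ℕ) c → (∀ w → f w ≤ c) → ∑ (words n) f ≤ 2 ^ n * c
∑-words-≤ {zero}  f c f≤c = +-monoˡ-≤ 0 (f≤c [])
∑-words-≤ {suc n} f c f≤c = begin
  ∑ (words (suc n)) f ≡⟨ ∑-words-suc f ⟩
  _                   ≤⟨ +-mono-≤ (∑-words-≤ _ c (f≤c ∘ (false ∷_))) (∑-words-≤ _ c (f≤c ∘ (true ∷_))) ⟩
  2 ^ n * c + 2 ^ n * c ≡⟨ lemma (2 ^ n) c ⟩
  2 * 2 ^ n * c       ∎
  where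
  open ≤-Reasoning
  lemma : ∀ a c → a * c + a * c ≡ 2 * a * c
  lemma = solve-∀

_≟ʷ_ : DecidableEquality (Vec Bool n)
_≟ʷ_ = Vec.≡-dec Bool._≟_

-- Each word is listed exactly once in `words n`, so a single term survives.
∑-words-≡ : ∀ (v : Vec Bool n) (g : Vec Bool n → ℕ) →
            ∑ (words n) (λ w → ⟦ does (v ≟ʷ w) ⟧ * g w) ≡ g v
∑-words-≡ []          g = trans (+-identityʳ _) (+-identityʳ _)
∑-words-≡ {suc n} (false ∷ v) g = trans (∑-words-suc {n} _)
  (trans (cong₂ _+_ (∑-words-≡ v (g ∘ (false ∷_))) (∑-zero (words n))) (+-identityʳ _))
∑-words-≡ {suc n} (true  ∷ v) g = trans (∑-words-suc {n} _)
  (cong₂ _+_ (∑-zero (words n)) (∑-words-≡ v (g ∘ (true ∷_))))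

∑-fibres : ∀ (h : A → Vec Bool n) (g : Vec Bool n → ℕ) xs →
           ∑ xs (g ∘ h) ≡ ∑ (words n) (λ w → ∑ xs (λ x → ⟦ does (h x ≟ʷ w) ⟧) * g w)
∑-fibres {n = n} h g xs = begin
  ∑ xs (g ∘ h)
    ≡⟨ ∑-cong xs (λ x → ∑-words-≡ (h x) g) ⟨
  ∑ xs (λ x → ∑ (words n) (λ w → ⟦ does (h x ≟ʷ w) ⟧ * g w))
    ≡⟨ ∑-swap (λ x w → ⟦ does (h x ≟ʷ w) ⟧ * g w) xs (words n) ⟩
  ∑ (words n) (λ w → ∑ xs (λ x → ⟦ does (h x ≟ʷ w) ⟧ * g w))
    ≡⟨ ∑-cong (words n) (λ w → ∑-*ʳ (g w) (λ x → ⟦ does (h x ≟ʷ w) ⟧) xs) ⟩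
  ∑ (words n) (λ w → ∑ xs (λ x → ⟦ does (h x ≟ʷ w) ⟧) * g w) ∎
  where open ≡-Reasoning

-- The Marcus–Tardos theorem

-- A permutation matrix given by its ones: the e-th lies in row α e and column β e. In this form
-- transposition just exchanges α and β.
Pattern : (α β : Permutation′ k) → (ℕ → ℕ → Bool) → Set
Pattern {k} α β M = ∃₂ λ (r c : Fin k → ℕ) → Increasing r × Increasing c ×
  (∀ e → M (r (α ⟨$⟩ʳ e)) (c (β ⟨$⟩ʳ e)) ≡ true)

Pattern-flip : ∀ (α β : Permutation′ k) {M} → Pattern β α (flip M) → Pattern α β M
Pattern-flip α β (r , c , r↑ , c↑ , h) = c , r , c↑ , r↑ , h

count : (ℕ → ℕ → Bool) → ℕ → ℕ
count M n = ∑ (upTo n) λ i → ∑ (upTo n) λ j → ⟦ M i j ⟧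

*+-mono-< : ∀ {s I I′ r r′} → I < I′ → r < s → I * s + r < I′ * s + r′
*+-mono-< {s} {I} {I′} {r} {r′} I<I′ r<s = begin-strict
  I * s + r   <⟨ +-monoʳ-< (I * s) r<s ⟩
  I * s + s   ≡⟨ +-comm (I * s) s ⟩
  suc I * s   ≤⟨ *-monoˡ-≤ s I<I′ ⟩
  I′ * s      ≤⟨ m≤m+n (I′ * s) r′ ⟩
  I′ * s + r′ ∎
  where open ≤-Reasoning

-- Block (I, J) consists of the entries (I * s + r, J * s + q) with r, q < s, and `profile` records
-- its nonempty columns. Blocks with many nonempty rows are handled as wide blocks of the transpose.
module Blocks (k s : ℕ) (M : ℕ → ℕ → Bool) where

  column : ℕ → ℕ → ℕ → Bool
  column I J q = any (λ r → M (I * s + r) (J * s + q)) (upTo s)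

  contract : ℕ → ℕ → Bool
  contract I J = any (λ r → any (λ q → M (I * s + r) (J * s + q)) (upTo s)) (upTo s)

  profile : ℕ → ℕ → Vec Bool s
  profile I J = Vec.tabulate (column I J ∘ toℕ)

  heavy : Vec Bool s → Bool
  heavy w = does (k ≤? ∑ (upTo s) (⟦_⟧ ∘ at w))

  wide : ℕ → ℕ → Bool
  wide I J = heavy (profile I J)

  block : ℕ → ℕ → ℕ
  block I J = ∑ (upTo s) λ r → ∑ (upTo s) λ q → ⟦ M (I * s + r) (J * s + q) ⟧

  -- Distinct ones of the pattern lie in distinct rows and distinct columns of blocks, so any 1 may
  -- be picked from each block without disturbing the order.
  contract-Pattern : ∀ (α β : Permutation′ k) → Pattern α β contract → Pattern α β M
  contract-Pattern α β (r , c , r↑ , c↑ , h) = r′ , c′ ,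
    (λ i<j → *+-mono-< (r↑ i<j) (ρ-< _)) , (λ i<j → *+-mono-< (c↑ i<j) (γ-< _)) , h′
    where
    row : ∀ e → ∃ λ x → x ∈ upTo s × any (λ q → M (r (α ⟨$⟩ʳ e) * s + x) (c (β ⟨$⟩ʳ e) * s + q)) (upTo s) ≡ true
    row e = any-∃ _ (upTo s) (h e)
    ρ : Fin k → ℕ
    ρ e = proj₁ (row e)
    ρ-< : ∀ e → ρ e < s
    ρ-< e = ∈-upTo⁻ (proj₁ (proj₂ (row e)))
    col : ∀ e → ∃ λ q → q ∈ upTo s × M (r (α ⟨$⟩ʳ e) * s + ρ e) (c (β ⟨$⟩ʳ e) * s + q) ≡ true
    col e = any-∃ _ (upTo s) (proj₂ (proj₂ (row e)))
    γ : Fin k → ℕ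
    γ e = proj₁ (col e)
    γ-< : ∀ e → γ e < s
    γ-< e = ∈-upTo⁻ (proj₁ (proj₂ (col e)))
    -- Row i belongs to the 1 numbered by the inverse image of i under α, column j to the inverse
    -- image of j under β.
    r′ c′ : Fin k → ℕ
    r′ i = r i * s + ρ (α ⟨$⟩ˡ i)
    c′ j = c j * s + γ (β ⟨$⟩ˡ j)
    h′ : ∀ e → M (r′ (α ⟨$⟩ʳ e)) (c′ (β ⟨$⟩ʳ e)) ≡ true
    h′ e rewrite inverseˡ α {e} | inverseˡ β {e} = proj₂ (proj₂ (col e))

  -- The i-th of k blocks with the same nonempty columns supplies row i of the
  -- pattern: any required column among these meets some row of the block in a 1.
  profile-Pattern : ∀ (α β : Permutation′ k) J w N → heavy w ≡ true →
                    k ≤ ∑ (upTo N) (λ I → ⟦ does (profile I J ≟ʷ w) ⟧) → Pattern α β M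
  profile-Pattern α β J w N hw kN
    with I , I↑ , I-w ← enumerate (λ I → does (profile I J ≟ʷ w)) N k kN
    with q , q↑ , w-q ← enumerate (at w) s k (does-true (_ ≤? _) hw)
    = r , c , (λ i<j → *+-mono-< (I↑ i<j) (∈-upTo⁻ (proj₁ (proj₂ (witness _ _)))))
    , (λ i<j → +-monoʳ-< (J * s) (q↑ i<j)) , h
    where
    nonempty : ∀ i j → column (I i) J (q j) ≡ true
    nonempty i j = begin
      column (I i) J (q j)     ≡⟨ at-tabulate {s} (column (I i) J) (proj₁ (w-q j)) ⟨
      at (profile (I i) J) (q j) ≡⟨ cong (λ v → at v (q j)) (does-true (profile (I i) J ≟ʷ w) (proj₂ (I-w i))) ⟩
      at w (q j)               ≡⟨ proj₂ (w-q j) ⟩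
      true                     ∎
      where open ≡-Reasoning
    witness : ∀ i j → ∃ λ x → x ∈ upTo s × M (I i * s + x) (J * s + q j) ≡ true
    witness i j = any-∃ _ (upTo s) (nonempty i j)
    r c : Fin k → ℕ
    r i = I i * s + proj₁ (witness i (β ⟨$⟩ʳ (α ⟨$⟩ˡ i)))
    c j = J * s + q j
    h : ∀ e → M (r (α ⟨$⟩ʳ e)) (c (β ⟨$⟩ʳ e)) ≡ true
    h e rewrite inverseˡ α {e} = proj₂ (proj₂ (witness (α ⟨$⟩ʳ e) (β ⟨$⟩ʳ e)))

  -- Pigeonhole: there are 2 ^ s profiles, and fewer than k blocks above one another can share a
  -- heavy one.
  wide-bound : ∀ (α β : Permutation′ k) → ¬ Pattern α β M →
               ∀ J N → ∑ (upTo N) (λ I → ⟦ wide I J ⟧) ≤ 2 ^ s * k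
  wide-bound α β avoids J N = begin
    ∑ (upTo N) (λ I → ⟦ heavy (profile I J) ⟧)
      ≡⟨ ∑-fibres (λ I → profile I J) (⟦_⟧ ∘ heavy) (upTo N) ⟩
    ∑ (words s) (λ w → occurrences w * ⟦ heavy w ⟧)
      ≤⟨ ∑-words-≤ _ k bound ⟩
    2 ^ s * k ∎
    where
    open ≤-Reasoning
    occurrences : Vec Bool s → ℕ
    occurrences w = ∑ (upTo N) (λ I → ⟦ does (profile I J ≟ʷ w) ⟧)
    bound : ∀ w → occurrences w * ⟦ heavy w ⟧ ≤ k
    bound w with heavy w in hw
    ... | false = ≤-trans (≤-reflexive (*-zeroʳ (occurrences w))) z≤n
    ... | true with k ≤? occurrences w
    ...   | yes k≤ = contradiction (profile-Pattern α β J w N hw k≤) avoids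
    ...   | no  k≰ = ≤-trans (≤-reflexive (*-identityʳ (occurrences w))) (<⇒≤ (≰⇒> k≰))

  columns-bound : ∀ {I J} → wide I J ≡ false → ∑ (upTo s) (⟦_⟧ ∘ column I J) ≤ k
  columns-bound {I} {J} narrow = begin
    ∑ (upTo s) (⟦_⟧ ∘ column I J)
      ≤⟨ ∑-mono-∈ (upTo s) (λ q∈ → ≤-reflexive (cong ⟦_⟧ (sym (at-tabulate {s} (column I J) (∈-upTo⁻ q∈))))) ⟩
    ∑ (upTo s) (⟦_⟧ ∘ at (profile I J))
      ≤⟨ <⇒≤ (≰⇒> (does-false (_ ≤? _) narrow)) ⟩
    k ∎
    where open ≤-Reasoning

module _ (k s : ℕ) (M : ℕ → ℕ → Bool) where
  open Blocks k s M
  private module T = Blocks k s (flip M)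

  -- An empty block contributes nothing. A block that is neither wide nor tall has fewer than k
  -- nonempty rows and fewer than k nonempty columns; for the others the trivial bound s * s is
  -- used.
  block-≤ : ∀ I J → block I J ≤ k * k * ⟦ contract I J ⟧ + s * s * (⟦ wide I J ⟧ + ⟦ T.wide J I ⟧)
  block-≤ I J with contract I J in cIJ
  ... | false = ≤-trans (≤-reflexive empty) z≤n
    where
    cell : ∀ {r q} → r ∈ upTo s → q ∈ upTo s → ⟦ M (I * s + r) (J * s + q) ⟧ ≤ 0
    cell {r} {q} r∈ q∈ with M (I * s + r) (J * s + q) in Mrq
    ... | false = z≤n
    ... | true with () ← trans (sym cIJ) (∃-any _ r∈ (∃-any _ q∈ Mrq))
    empty : block I J ≡ 0
    empty = n≤0⇒n≡0 (begin
      block I J               ≤⟨ ∑-mono-∈ (upTo s) (λ r∈ → ∑-mono-∈ (upTo s) (cell r∈)) ⟩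
      ∑ (upTo s) (λ _ → ∑ (upTo s) λ _ → 0) ≡⟨ ∑-cong (upTo s) (λ _ → ∑-zero (upTo s)) ⟩
      ∑ (upTo s) (λ _ → 0)    ≡⟨ ∑-zero (upTo s) ⟩
      0                       ∎)
      where open ≤-Reasoning
  ... | true = split (wide I J) (T.wide J I) refl refl
    where
    open ≤-Reasoning
    everything : block I J ≤ s * s
    everything = subst (λ l → block I J ≤ l * l) (length-upTo s)
      (∑-≤ (upTo s) (λ {r} _ → ≤-trans (∑-≤ (upTo s) (λ {q} _ → ⟦⟧≤1 _)) (≤-reflexive (*-identityʳ _))))
    -- The ones lie in the product of the nonempty rows and the nonempty columns.
    cell : ∀ {r q} → r ∈ upTo s → q ∈ upTo s →
           ⟦ M (I * s + r) (J * s + q) ⟧ ≤ ⟦ T.column J I r ⟧ * ⟦ column I J q ⟧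
    cell {r} {q} r∈ q∈ with M (I * s + r) (J * s + q) in Mrq
    ... | false = z≤n
    ... | true rewrite ∃-any (λ q → M (I * s + r) (J * s + q)) q∈ Mrq
                     | ∃-any (λ r → M (I * s + r) (J * s + q)) r∈ Mrq = ≤-refl
    split : ∀ a b → wide I J ≡ a → T.wide J I ≡ b → block I J ≤ k * k * 1 + s * s * (⟦ a ⟧ + ⟦ b ⟧)
    split true  b     _ _ = ≤-trans everything (≤-trans (m≤m*n (s * s) (1 + ⟦ b ⟧)) (m≤n+m _ _))
    split false true  _ _ = ≤-trans everything (≤-trans (m≤m*n (s * s) 1) (m≤n+m _ _))
    split false false narrow short = begin
      block I J
        ≤⟨ ∑-mono-∈ (upTo s) (λ r∈ → ∑-mono-∈ (upTo s) (cell r∈)) ⟩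
      ∑ (upTo s) (λ r → ∑ (upTo s) λ q → ⟦ T.column J I r ⟧ * ⟦ column I J q ⟧)
        ≡⟨ ∑-cong (upTo s) (λ r → ∑-*ˡ ⟦ T.column J I r ⟧ (⟦_⟧ ∘ column I J) (upTo s)) ⟩
      ∑ (upTo s) (λ r → ⟦ T.column J I r ⟧ * ∑ (upTo s) (⟦_⟧ ∘ column I J))
        ≡⟨ ∑-*ʳ _ (⟦_⟧ ∘ T.column J I) (upTo s) ⟩
      ∑ (upTo s) (⟦_⟧ ∘ T.column J I) * ∑ (upTo s) (⟦_⟧ ∘ column I J)
        ≤⟨ *-mono-≤ (T.columns-bound {J} {I} short) (columns-bound {I} {J} narrow) ⟩
      k * k
        ≡⟨ *-identityʳ (k * k) ⟨
      k * k * 1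
        ≤⟨ m≤m+n _ _ ⟩
      k * k * 1 + s * s * 0 ∎

  count-blocks : ∀ N → count M (N * s) ≡ ∑ (upTo N) λ I → ∑ (upTo N) λ J → block I J
  count-blocks N = begin
    count M (N * s)
      ≡⟨ ∑-upTo-* _ s N ⟩
    ∑ (upTo N) (λ I → ∑ (upTo s) λ r → ∑ (upTo (N * s)) λ j → ⟦ M (I * s + r) j ⟧)
      ≡⟨ ∑-cong (upTo N) (λ I → ∑-cong (upTo s) λ r → ∑-upTo-* _ s N) ⟩
    ∑ (upTo N) (λ I → ∑ (upTo s) λ r → ∑ (upTo N) λ J → ∑ (upTo s) λ q → ⟦ M (I * s + r) (J * s + q) ⟧)
      ≡⟨ ∑-cong (upTo N) (λ I → ∑-swap _ (upTo s) (upTo N)) ⟩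
    ∑ (upTo N) (λ I → ∑ (upTo N) λ J → block I J) ∎
    where open ≡-Reasoning

  -- Summation of `block-≤` over all blocks. Wide blocks are few in each column of blocks, tall ones
  -- in each row of blocks.
  count-contract : ∀ (α β : Permutation′ k) → ¬ Pattern α β M → ∀ N →
                   count M (N * s) ≤ k * k * count contract N + s * s * (2 * (N * (2 ^ s * k)))
  count-contract α β avoids N = begin
    count M (N * s)
      ≡⟨ count-blocks N ⟩
    ∑ (upTo N) (λ I → ∑ (upTo N) λ J → block I J)
      ≤⟨ ∑-mono (upTo N) (λ I → ∑-mono (upTo N) (block-≤ I)) ⟩
    ∑ (upTo N) (λ I → ∑ (upTo N) λ J → k * k * C I J + s * s * (W I J + T I J))
      ≡⟨ ∑∑-+ (λ I J → k * k * C I J) (λ I J → s * s * (W I J + T I J)) ⟩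
    ∑∑ (λ I J → k * k * C I J) + ∑∑ (λ I J → s * s * (W I J + T I J))
      ≡⟨ cong₂ _+_ (∑∑-*ˡ (k * k) C) (∑∑-*ˡ (s * s) (λ I J → W I J + T I J)) ⟩
    k * k * ∑∑ C + s * s * ∑∑ (λ I J → W I J + T I J)
      ≡⟨ cong (λ x → k * k * ∑∑ C + s * s * x) (∑∑-+ W T) ⟩
    k * k * ∑∑ C + s * s * (∑∑ W + ∑∑ T)
      ≤⟨ +-monoʳ-≤ (k * k * ∑∑ C) (*-monoʳ-≤ (s * s) (+-mono-≤ wides talls)) ⟩
    k * k * ∑∑ C + s * s * (N * b + N * b)
      ≡⟨ cong (λ x → k * k * ∑∑ C + s * s * (N * b + x)) (sym (+-identityʳ (N * b))) ⟩
    k * k * ∑∑ C + s * s * (2 * (N * b)) ∎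
    where
    open ≤-Reasoning
    b = 2 ^ s * k
    C W T : ℕ → ℕ → ℕ
    C I J = ⟦ contract I J ⟧
    W I J = ⟦ wide I J ⟧
    T I J = ⟦ T.wide J I ⟧
    ∑∑ : (ℕ → ℕ → ℕ) → ℕ
    ∑∑ f = ∑ (upTo N) λ I → ∑ (upTo N) (f I)
    ∑∑-+ : ∀ f g → ∑∑ (λ I J → f I J + g I J) ≡ ∑∑ f + ∑∑ g
    ∑∑-+ f g = trans (∑-cong (upTo N) (λ I → ∑-+ (f I) (g I) (upTo N))) (∑-+ _ _ (upTo N))
    ∑∑-*ˡ : ∀ c f → ∑∑ (λ I J → c * f I J) ≡ c * ∑∑ f
    ∑∑-*ˡ c f = trans (∑-cong (upTo N) (λ I → ∑-*ˡ c (f I) (upTo N))) (∑-*ˡ c _ (upTo N))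
    sumN : ∀ {f : ℕ → ℕ} → (∀ I → f I ≤ b) → ∑ (upTo N) f ≤ N * b
    sumN {f} f≤b = subst (λ l → ∑ (upTo N) f ≤ l * b) (length-upTo N) (∑-≤ (upTo N) (λ {I} _ → f≤b I))
    wides : ∑∑ W ≤ N * b
    wides = ≤-trans (≤-reflexive (∑-swap W (upTo N) (upTo N))) (sumN (λ J → wide-bound α β avoids J N))
    talls : ∑∑ T ≤ N * b
    talls = sumN (λ I → T.wide-bound β α (avoids ∘ Pattern-flip α β {M}) I N)

count-mono : ∀ M → m ≤ n → count M m ≤ count M n
count-mono {m} M m≤n = ≤-trans (∑-mono (upTo m) (λ i → ∑-upTo-≤ _ m≤n)) (∑-upTo-≤ _ m≤n)

-- One more than k * k: the recursion multiplies by k * k while the order grows by this factor, and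
-- the difference absorbs the additive term.
side : ℕ → ℕ
side k = suc (k * k)

-- The last factor pays for enlarging n to a power of the block side.
mt-constant : ℕ → ℕ
mt-constant k = suc (side k * side k * (2 * (2 ^ side k * k))) * side k

-- The contracted matrix has order s ^ t and avoids the same pattern, so induction on t applies to
-- it.
marcus-tardos-^ : ∀ (α β : Permutation′ k) → let s = side k in
  ∀ t M → ¬ Pattern α β M → count M (s ^ t) ≤ suc (s * s * (2 * (2 ^ s * k))) * s ^ t
marcus-tardos-^ {k} α β zero M avoids with M 0 0
... | true  = s≤s z≤n
... | false = z≤n
marcus-tardos-^ {k} α β (suc t) M avoids = begin
  count M (s * N)                              ≡⟨ cong (count M) (*-comm s N) ⟩
  count M (N * s)                              ≤⟨ count-contract k s M α β avoids N ⟩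
  k * k * count contract N + s * s * (2 * (N * (2 ^ s * k)))
    ≤⟨ +-monoˡ-≤ _ (*-monoʳ-≤ (k * k) (marcus-tardos-^ α β t contract (avoids ∘ contract-Pattern α β))) ⟩
  k * k * (suc c * N) + s * s * (2 * (N * (2 ^ s * k)))
    ≤⟨ m≤m+n _ N ⟩
  k * k * (suc c * N) + s * s * (2 * (N * (2 ^ s * k))) + N
    ≡⟨ lemma (k * k) s (2 ^ s * k) N ⟩
  suc c * (s * N) ∎
  where
  open ≤-Reasoning
  s = side k
  c = s * s * (2 * (2 ^ s * k))
  N = s ^ t
  open Blocks k s M
  lemma : ∀ a s x N → a * (suc (s * s * (2 * x)) * N) + s * s * (2 * (N * x)) + N ≡
                      suc (s * s * (2 * x)) * (suc a * N)
  lemma = solve-∀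

power-between : ∀ s → 2 ≤ s → ∀ n → ∃ λ t → suc n ≤ s ^ t × s ^ t ≤ s * suc n
power-between s 2≤s zero = 0 , s≤s z≤n , ≤-trans (<⇒≤ 2≤s) (≤-reflexive (sym (*-identityʳ s)))
power-between s 2≤s (suc n) with power-between s 2≤s n
... | t , n<s^t , s^t≤sn with suc (suc n) ≤? s ^ t
...   | yes n≤ = t , n≤ , ≤-trans s^t≤sn (*-monoʳ-≤ s (n≤1+n (suc n)))
...   | no  n≰ = suc t , lower , *-monoʳ-≤ s (<⇒≤ (≰⇒> n≰))
  where
  open ≤-Reasoning
  lower : suc (suc n) ≤ s * s ^ t
  lower = begin
    1 + suc n         ≤⟨ +-monoˡ-≤ (suc n) (s≤s z≤n) ⟩
    suc n + suc n     ≡⟨ cong (suc n +_) (sym (+-identityʳ (suc n))) ⟩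
    2 * suc n         ≤⟨ *-mono-≤ 2≤s n<s^t ⟩
    s * s ^ t         ∎

-- Since M is defined on all of ℕ, the order can be raised to a power of the side. Positive pattern
-- size makes the side at least 2, so that such a power exists within a factor `side` of n.
marcus-tardos : ∀ (α β : Permutation′ (suc k)) M → ¬ Pattern α β M →
                ∀ n → count M n ≤ mt-constant (suc k) * n
marcus-tardos α β M avoids zero    = z≤n
marcus-tardos {k} α β M avoids (suc n)
  with t , n<s^t , s^t≤sn ← power-between (side (suc k)) (s≤s (s≤s z≤n)) n = begin
  count M (suc n)  ≤⟨ count-mono M n<s^t ⟩
  count M (s ^ t)  ≤⟨ marcus-tardos-^ α β t M avoids ⟩
  c * s ^ t        ≤⟨ *-monoʳ-≤ c s^t≤sn ⟩
  c * (s * suc n)  ≡⟨ *-assoc c s (suc n) ⟨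
  c * s * suc n    ∎
  where
  open ≤-Reasoning
  s = side (suc k)
  c = suc (s * s * (2 * (2 ^ s * suc k)))

-- Ordered graphs

-- An ordered matching: edge e joins a (κ e) to b (μ e), and every left end precedes every right
-- end.
GraphPattern : (κ μ : Permutation′ k) → (ℕ → ℕ → Bool) → Set
GraphPattern {k} κ μ H = ∃₂ λ (a b : Fin k → ℕ) → Increasing a × Increasing b ×
  (∀ i j → a i < b j) × (∀ e → H (a (κ ⟨$⟩ʳ e)) (b (μ ⟨$⟩ʳ e)) ≡ true)

-- Only the part above the diagonal is kept, so `count` sees each pair of vertices once.
edge : (ℕ → ℕ → Bool) → ℕ → ℕ → Bool
edge H x y = does (x <? y) ∧ H x y

edge⁺ : ∀ H {x y} → x < y → H x y ≡ true → edge H x y ≡ true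
edge⁺ H x<y Hxy = cong₂ _∧_ (dec-true (_ <? _) x<y) Hxy

edge⁻ : ∀ H {x y} → edge H x y ≡ true → x < y × H x y ≡ true
edge⁻ H {x} {y} h with ∧-true {does (x <? y)} h
... | x<y , Hxy = does-true (x <? y) x<y , Hxy

punchIn-fromℕ-< : ∀ (i : Fin k) → punchIn (fromℕ k) i Fin.< fromℕ k
punchIn-fromℕ-< zero    = z<s
punchIn-fromℕ-< (suc i) = s<s (punchIn-fromℕ-< i)

punchIn-mono-< : ∀ (v : Fin (suc k)) {i j} → i Fin.< j → punchIn v i Fin.< punchIn v j
punchIn-mono-< zero    i<j = s<s i<j
punchIn-mono-< (suc v) {zero}  {suc j} i<j = z<s
punchIn-mono-< (suc v) {suc i} {suc j} i<j = s<s (punchIn-mono-< v (s<s⁻¹ i<j))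

-- The extra 1 in the last row and first column of the enlarged pattern lies
-- above the diagonal, which forces all a i to precede all b j.
sparse : ∀ (κ μ : Permutation′ k) H → ¬ GraphPattern κ μ H →
         ∀ n → count (edge H) n ≤ mt-constant (suc k) * n
sparse {k} κ μ H avoids =
  marcus-tardos (insert zero (fromℕ k) κ) (lift₀ μ) (edge H) (avoids ∘ restrict)
  where
  restrict : Pattern (insert zero (fromℕ k) κ) (lift₀ μ) (edge H) → GraphPattern κ μ H
  restrict (r , c , r↑ , c↑ , h) =
    r ∘ punchIn (fromℕ k) , c ∘ suc , r↑ ∘ punchIn-mono-< (fromℕ k) , c↑ ∘ s<s , separated , edges
    where
    r-last<c-first : r (fromℕ k) < c zero
    r-last<c-first = proj₁ (edge⁻ H (h zero))
    separated : ∀ i j → r (punchIn (fromℕ k) i) < c (suc j)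
    separated i j = <-trans (r↑ (punchIn-fromℕ-< i)) (<-trans r-last<c-first (c↑ z<s))
    edges : ∀ e → H (r (punchIn (fromℕ k) (κ ⟨$⟩ʳ e))) (c (suc (μ ⟨$⟩ʳ e))) ≡ true
    edges e = subst (λ i → H (r i) (c (suc (μ ⟨$⟩ʳ e))) ≡ true)
      (insert-punchIn zero (fromℕ k) κ e) (proj₂ (edge⁻ H (h (suc e))))

-- Cliques

-- The analogue of `punchIn` on ℕ: it renumbers the vertices left after the deletion of v.
skip : ℕ → ℕ → ℕ
skip zero    i       = suc i
skip (suc v) zero    = zero
skip (suc v) (suc i) = suc (skip v i)

skip-mono-< : ∀ v {i j} → i < j → skip v i < skip v j
skip-mono-< zero    i<j = s<s i<j
skip-mono-< (suc v) {zero}  {suc j} i<j = z<s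
skip-mono-< (suc v) {suc i} {suc j} i<j = s<s (skip-mono-< v (s<s⁻¹ i<j))

skip-≢ : ∀ v i → skip v i ≢ v
skip-≢ (suc v) (suc i) eq = skip-≢ v i (suc-injective eq)

∑-skip : ∀ v (f : ℕ → ℕ) n → ∑ (upTo n) (f ∘ skip v) ≤ ∑ (upTo (suc n)) f
∑-skip zero    f n       = ≤-trans (m≤n+m _ (f 0)) (≤-reflexive (sym (∑-upTo-suc f n)))
∑-skip (suc v) f zero    = z≤n
∑-skip (suc v) f (suc n) = begin
  ∑ (upTo (suc n)) (f ∘ skip (suc v))     ≡⟨ ∑-upTo-suc (f ∘ skip (suc v)) n ⟩
  f 0 + ∑ (upTo n) (f ∘ suc ∘ skip v)     ≤⟨ +-monoʳ-≤ (f 0) (∑-skip v (f ∘ suc) n) ⟩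
  f 0 + ∑ (upTo (suc n)) (f ∘ suc)        ≡⟨ ∑-upTo-suc f (suc n) ⟨
  ∑ (upTo (suc (suc n))) f                ∎
  where open ≤-Reasoning

ins : ℕ → Bool → Vec Bool n → Vec Bool (suc n)
ins zero    b w       = b ∷ w
-- Out of range, with an arbitrary value: the lemmas on `ins` assume v ≤ n.
ins (suc v) b []      = b ∷ []
ins (suc v) b (x ∷ w) = x ∷ ins v b w

at-ins : ∀ {v} b (w : Vec Bool n) → v ≤ n → at (ins v b w) v ≡ b
at-ins {v = zero}  b w       _   = refl
at-ins {v = suc v} b (x ∷ w) v≤n = at-ins b w (s≤s⁻¹ v≤n)

at-ins-skip : ∀ {v} b (w : Vec Bool n) i → v ≤ n → at (ins v b w) (skip v i) ≡ at w i
at-ins-skip {v = zero}  b w       i       _   = refl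
at-ins-skip {v = suc v} b (x ∷ w) zero    v≤n = refl
at-ins-skip {v = suc v} b (x ∷ w) (suc i) v≤n = at-ins-skip b w i (s≤s⁻¹ v≤n)

-- Every word of length n + 1 arises exactly once by inserting a letter at position v.
∑-words-ins : ∀ {v} (f : Vec Bool (suc n) → ℕ) → v ≤ n →
              ∑ (words (suc n)) f ≡ ∑ (words n) (f ∘ ins v false) + ∑ (words n) (f ∘ ins v true)
∑-words-ins {v = zero} f _ = ∑-words-suc f
∑-words-ins {n = suc n} {v = suc v} f v≤n = begin
  ∑ (words (suc (suc n))) f
    ≡⟨ ∑-words-suc f ⟩
  ∑ (words (suc n)) (f ∘ (false ∷_)) + ∑ (words (suc n)) (f ∘ (true ∷_))
    ≡⟨ cong₂ _+_ (∑-words-ins (f ∘ (false ∷_)) (s≤s⁻¹ v≤n)) (∑-words-ins (f ∘ (true ∷_)) (s≤s⁻¹ v≤n)) ⟩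
  _ ≡⟨ interchange (S false false) (S false true) (S true false) (S true true) ⟩
  _ ≡⟨ cong₂ _+_ (sym (∑-words-suc (f ∘ ins (suc v) false))) (sym (∑-words-suc (f ∘ ins (suc v) true))) ⟩
  ∑ (words (suc n)) (f ∘ ins (suc v) false) + ∑ (words (suc n)) (f ∘ ins (suc v) true) ∎
  where
  open ≡-Reasoning
  S : Bool → Bool → ℕ
  S a b = ∑ (words n) (λ w → f (a ∷ ins v b w))
  interchange : ∀ a b c d → (a + b) + (c + d) ≡ (a + c) + (b + d)
  interchange = solve-∀

-- All words satisfying Q are subsets of N. The induction reads one letter at a time: the sum can
-- double only where N holds.
∑-words-support : ∀ (Q : Vec Bool n → Bool) (N : ℕ → Bool) →
  (∀ w → Q w ≡ true → ∀ i → at w i ≡ true → N i ≡ true) →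
  ∑ (words n) (⟦_⟧ ∘ Q) ≤ 2 ^ ∑ (upTo n) (⟦_⟧ ∘ N)
∑-words-support {zero}  Q N supp = ≤-trans (≤-reflexive (+-identityʳ _)) (⟦⟧≤1 (Q []))
∑-words-support {suc n} Q N supp = begin
  ∑ (words (suc n)) (⟦_⟧ ∘ Q)
    ≡⟨ ∑-words-suc (⟦_⟧ ∘ Q) ⟩
  ∑ (words n) (⟦_⟧ ∘ Q ∘ (false ∷_)) + ∑ (words n) (⟦_⟧ ∘ Q ∘ (true ∷_))
    ≤⟨ +-mono-≤ (half false) (halfᵗ (N 0) refl) ⟩
  2 ^ D + ⟦ N 0 ⟧ * 2 ^ D
    ≡⟨ double (N 0) ⟩
  2 ^ (⟦ N 0 ⟧ + D)
    ≡⟨ cong (2 ^_) (∑-upTo-suc (⟦_⟧ ∘ N) n) ⟨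
  2 ^ ∑ (upTo (suc n)) (⟦_⟧ ∘ N) ∎
  where
  open ≤-Reasoning
  D = ∑ (upTo n) (⟦_⟧ ∘ N ∘ suc)
  half : ∀ b → ∑ (words n) (⟦_⟧ ∘ Q ∘ (b ∷_)) ≤ 2 ^ D
  half b = ∑-words-support (Q ∘ (b ∷_)) (N ∘ suc) (λ w Qw i → supp (b ∷ w) Qw (suc i))
  halfᵗ : ∀ b → N 0 ≡ b → ∑ (words n) (⟦_⟧ ∘ Q ∘ (true ∷_)) ≤ ⟦ b ⟧ * 2 ^ D
  halfᵗ true  _  = ≤-trans (half true) (≤-reflexive (sym (+-identityʳ _)))
  halfᵗ false N0 = ≤-trans (∑-mono (words n) none) (≤-reflexive (∑-zero (words n)))
    where
    none : ∀ w → ⟦ Q (true ∷ w) ⟧ ≤ 0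
    none w with Q (true ∷ w) in Qw
    ... | false = z≤n
    ... | true with () ← trans (sym N0) (supp (true ∷ w) Qw 0 refl)
  double : ∀ b → 2 ^ D + ⟦ b ⟧ * 2 ^ D ≡ 2 ^ (⟦ b ⟧ + D)
  double true  = refl
  double false = +-identityʳ _

degree : (ℕ → ℕ → Bool) → ℕ → ℕ → ℕ
degree H n v = ∑ (upTo n) (λ y → ⟦ edge H v y ⟧) + ∑ (upTo n) (λ y → ⟦ edge H y v ⟧)

-- Handshake lemma: each edge is counted at both ends.
∑-degree : ∀ H n → ∑ (upTo n) (degree H n) ≡ 2 * count (edge H) n
∑-degree H n = begin
  ∑ (upTo n) (degree H n)
    ≡⟨ ∑-+ _ _ (upTo n) ⟩
  count (edge H) n + ∑ (upTo n) (λ v → ∑ (upTo n) (λ y → ⟦ edge H y v ⟧))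
    ≡⟨ cong (count (edge H) n +_) (∑-swap _ (upTo n) (upTo n)) ⟩
  count (edge H) n + count (edge H) n
    ≡⟨ cong (count (edge H) n +_) (+-identityʳ _) ⟨
  2 * count (edge H) n ∎
  where open ≡-Reasoning

low-degree : ∀ H c n → count (edge H) (suc n) ≤ c * suc n →
             ∃ λ v → v ≤ n × degree H (suc n) v ≤ 2 * c
low-degree H c n few = ∑-upTo-average (degree H (suc n)) (2 * c) n (begin
  ∑ (upTo (suc n)) (degree H (suc n)) ≡⟨ ∑-degree H (suc n) ⟩
  2 * count (edge H) (suc n)          ≤⟨ *-monoʳ-≤ 2 few ⟩
  2 * (c * suc n)                     ≡⟨ *-assoc 2 c (suc n) ⟨
  2 * c * suc n                       ∎)
  where open ≤-Reasoning

GraphPattern-skip : ∀ (κ μ : Permutation′ k) {H} v →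
  GraphPattern κ μ (λ x y → H (skip v x) (skip v y)) → GraphPattern κ μ H
GraphPattern-skip κ μ v (a , b , a↑ , b↑ , a<b , h) =
  skip v ∘ a , skip v ∘ b , skip-mono-< v ∘ a↑ , skip-mono-< v ∘ b↑ ,
  (λ i j → skip-mono-< v (a<b i j)) , h

Clique : (ℕ → ℕ → Bool) → (ℕ → Bool) → Set
Clique H S = ∀ {x y} → x < y → S x ≡ true → S y ≡ true → H x y ≡ true

⟦∨⟧≤ : ∀ a b → ⟦ a ∨ b ⟧ ≤ ⟦ a ⟧ + ⟦ b ⟧
⟦∨⟧≤ true  b = s≤s z≤n
⟦∨⟧≤ false b = ≤-refl

-- A graph without the pattern has a vertex of degree at most 2c.  A clique either
-- avoids that vertex or is determined by a subset of its neighbours.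
cliques-bound : ∀ (κ μ : Permutation′ k) → let c = mt-constant (suc k) in
  ∀ n H → ¬ GraphPattern κ μ H →
  (Q : Vec Bool n → Bool) → (∀ w → Q w ≡ true → Clique H (at w)) →
  ∑ (words n) (⟦_⟧ ∘ Q) ≤ 1 + n * 2 ^ (2 * c)
cliques-bound κ μ zero H avoids Q cliques =
  ≤-trans (≤-reflexive (+-identityʳ _)) (⟦⟧≤1 (Q []))
cliques-bound {k} κ μ (suc n) H avoids Q cliques
  with v , v≤n , deg≤ ← low-degree H (mt-constant (suc k)) n (sparse κ μ H avoids (suc n)) = begin
  ∑ (words (suc n)) (⟦_⟧ ∘ Q)
    ≡⟨ ∑-words-ins (⟦_⟧ ∘ Q) v≤n ⟩
  ∑ (words n) (⟦_⟧ ∘ Q ∘ ins v false) + ∑ (words n) (⟦_⟧ ∘ Q ∘ ins v true)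
    ≤⟨ +-mono-≤ without (∑-words-support (Q ∘ ins v true) N neighbours) ⟩
  1 + n * 2 ^ (2 * c) + 2 ^ ∑ (upTo n) (⟦_⟧ ∘ N)
    ≤⟨ +-monoʳ-≤ (1 + n * 2 ^ (2 * c)) (^-monoʳ-≤ 2 (≤-trans N-bound deg≤)) ⟩
  1 + n * 2 ^ (2 * c) + 2 ^ (2 * c)
    ≡⟨ cong suc (+-comm (n * 2 ^ (2 * c)) _) ⟩
  1 + suc n * 2 ^ (2 * c) ∎
  where
  open ≤-Reasoning
  c = mt-constant (suc k)
  -- The neighbours of v, in the numbering after the deletion of v.
  N : ℕ → Bool
  N i = edge H v (skip v i) ∨ edge H (skip v i) v
  at-skip : ∀ b w {i} → at w i ≡ true → at (ins v b w) (skip v i) ≡ true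
  at-skip b w {i} = trans (at-ins-skip b w i v≤n)
  without : ∑ (words n) (⟦_⟧ ∘ Q ∘ ins v false) ≤ 1 + n * 2 ^ (2 * c)
  without = cliques-bound κ μ n (λ x y → H (skip v x) (skip v y))
    (avoids ∘ GraphPattern-skip κ μ {H} v) (Q ∘ ins v false)
    (λ w Qw x<y wx wy → cliques _ Qw (skip-mono-< v x<y) (at-skip false w wx) (at-skip false w wy))
  neighbours : ∀ w → Q (ins v true w) ≡ true → ∀ i → at w i ≡ true → N i ≡ true
  neighbours w Qw i wi with <-cmp v (skip v i)
  ... | tri≈ _ eq _ = contradiction (sym eq) (skip-≢ v i)
  ... | tri< v<s _ _ = cong (_∨ edge H (skip v i) v)
        (edge⁺ H v<s (cliques _ Qw v<s (at-ins true w v≤n) (at-skip true w wi)))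
  ... | tri> _ _ s<v = trans (cong (edge H v (skip v i) ∨_)
        (edge⁺ H s<v (cliques _ Qw s<v (at-skip true w wi) (at-ins true w v≤n)))) (Bool.∨-zeroʳ _)
  N-bound : ∑ (upTo n) (⟦_⟧ ∘ N) ≤ degree H (suc n) v
  N-bound = begin
    ∑ (upTo n) (⟦_⟧ ∘ N)
      ≤⟨ ∑-mono (upTo n) (λ i → ⟦∨⟧≤ (edge H v (skip v i)) _) ⟩
    ∑ (upTo n) (λ i → ⟦ edge H v (skip v i) ⟧ + ⟦ edge H (skip v i) v ⟧)
      ≤⟨ ∑-skip v (λ y → ⟦ edge H v y ⟧ + ⟦ edge H y v ⟧) n ⟩
    ∑ (upTo (suc n)) (λ y → ⟦ edge H v y ⟧ + ⟦ edge H y v ⟧)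
      ≡⟨ ∑-+ (λ y → ⟦ edge H v y ⟧) (λ y → ⟦ edge H y v ⟧) (upTo (suc n)) ⟩
    degree H (suc n) v ∎

-- Distinct representatives

∑-allFin-suc : ∀ (f : Fin (suc m) → ℕ) → ∑ (allFin (suc m)) f ≡ f zero + ∑ (allFin m) (f ∘ suc)
∑-allFin-suc {m} f = cong (f zero +_)
  (trans (cong (λ xs → ∑ xs f) (sym (map-tabulate {n = m} (λ i → i) suc))) (∑-map f suc (allFin m)))

∑-allFin-≤1 : ∀ (p : Fin m → Bool) → (∀ {i j} → p i ≡ true → p j ≡ true → i ≡ j) →
              ∑ (allFin m) (⟦_⟧ ∘ p) ≤ 1
∑-allFin-≤1 {zero}  p unique = z≤n
∑-allFin-≤1 {suc m} p unique rewrite ∑-allFin-suc (⟦_⟧ ∘ p) with p zero in p0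
... | false = ∑-allFin-≤1 (p ∘ suc) (λ pi pj → Fin.suc-injective (unique pi pj))
... | true  = s≤s (≤-trans (∑-mono (allFin m) none) (≤-reflexive (∑-zero (allFin m))))
  where
  none : ∀ i → ⟦ p (suc i) ⟧ ≤ 0
  none i with p (suc i) in pi
  ... | false = z≤n
  ... | true with () ← unique p0 pi

∑-positive : ∀ (p : A → Bool) xs → 1 ≤ ∑ xs (⟦_⟧ ∘ p) → ∃ λ x → p x ≡ true
∑-positive p (x ∷ xs) h with p x in px
... | true  = x , px
... | false = ∑-positive p xs h

⟦⟧-split : ∀ a b → ⟦ b ⟧ ≤ ⟦ a ⟧ + ⟦ not a ∧ b ⟧
⟦⟧-split true  b = ⟦⟧≤1 b
⟦⟧-split false b = ≤-refl

∑-delete : ∀ (x : Fin m) p →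
  ∑ (allFin m) (⟦_⟧ ∘ p) ≤ suc (∑ (allFin m) (λ i → ⟦ not (does (i Fin.≟ x)) ∧ p i ⟧))
∑-delete {m} x p = begin
  ∑ (allFin m) (⟦_⟧ ∘ p)
    ≤⟨ ∑-mono (allFin m) (λ i → ⟦⟧-split (does (i Fin.≟ x)) (p i)) ⟩
  ∑ (allFin m) (λ i → ⟦ does (i Fin.≟ x) ⟧ + ⟦ not (does (i Fin.≟ x)) ∧ p i ⟧)
    ≡⟨ ∑-+ _ _ (allFin m) ⟩
  ∑ (allFin m) (λ i → ⟦ does (i Fin.≟ x) ⟧) + rest
    ≤⟨ +-monoˡ-≤ rest (∑-allFin-≤1 _ (λ i≡x j≡x →
         trans (does-true (_ Fin.≟ x) i≡x) (sym (does-true (_ Fin.≟ x) j≡x)))) ⟩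
  suc rest ∎
  where
  open ≤-Reasoning
  rest = ∑ (allFin m) (λ i → ⟦ not (does (i Fin.≟ x)) ∧ p i ⟧)

-- Greedy choice: deleting the first representative costs every other set at most one element, which
-- leaves enough for the k remaining sets.
distinct-representatives : ∀ k (p : Fin k → Fin m → Bool) →
  (∀ e → k ≤ ∑ (allFin m) (⟦_⟧ ∘ p e)) →
  ∃ λ (ρ : Fin k → Fin m) → (∀ {d e} → ρ d ≡ ρ e → d ≡ e) × (∀ e → p e (ρ e) ≡ true)
distinct-representatives zero p many = (λ ()) , (λ { {()} }) , λ ()
distinct-representatives {m} (suc k) p many
  with x , px ← ∑-positive (p zero) (allFin m) (≤-trans (s≤s z≤n) (many zero))
  with ρ , ρ-inj , ρ-p ← distinct-representatives k (λ e i → not (does (i Fin.≟ x)) ∧ p (suc e) i)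
    (λ e → s≤s⁻¹ (≤-trans (many (suc e)) (∑-delete x (p (suc e)))))
  = ρ′ , (λ {d} {e} → inj d e) , λ { zero → px ; (suc e) → proj₂ (∧-true (ρ-p e)) }
  where
  ρ′ : Fin (suc k) → Fin m
  ρ′ zero    = x
  ρ′ (suc e) = ρ e
  fresh : ∀ e → ρ e ≢ x
  fresh e eq with () ← trans (sym (proj₁ (∧-true (ρ-p e)))) (cong not (dec-true (ρ e Fin.≟ x) eq))
  inj : ∀ d e → ρ′ d ≡ ρ′ e → d ≡ e
  inj zero    zero    _  = refl
  inj zero    (suc e) eq = contradiction (sym eq) (fresh e)
  inj (suc d) zero    eq = contradiction eq (fresh d)
  inj (suc d) (suc e) eq = cong suc (ρ-inj eq)

-- Cutting a row into pieces, scanning from left to right: a piece ends at the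
-- first element y forming a non-heavy pair (x , y) with an element x of it.

module Scan (heavy : ℕ → ℕ → Bool) (row : ℕ → Bool) where

  -- The start t of the piece is a parameter because `origin`, which supplies it, is itself computed
  -- from `closesFrom`.
  lightFrom : ℕ → ℕ → ℕ → Bool
  lightFrom t x y = does (t ≤? x) ∧ row x ∧ row y ∧ not (heavy x y)

  closesFrom : ℕ → ℕ → Bool
  closesFrom t y = any (λ x → lightFrom t x y) (upTo y)

  -- The start of the piece in progress when the scan reaches y. After a cut at y the next piece
  -- starts at y + 1, so the closing element belongs to no later piece.
  origin : ℕ → ℕ
  origin zero    = zero
  origin (suc y) = if closesFrom (origin y) y then suc y else origin y

  light : ℕ → ℕ → Bool
  light x y = lightFrom (origin y) x y

  closes : ℕ → Bool
  closes y = closesFrom (origin y) y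

  piece : ℕ → ℕ → Bool
  piece y x = does (origin y ≤? x) ∧ row x

  origin-≤ : ∀ y → origin y ≤ y
  origin-≤ zero    = z≤n
  origin-≤ (suc y) with closes y
  ... | true  = ≤-refl
  ... | false = m≤n⇒m≤1+n (origin-≤ y)

  -- The cut moves the origin to y + 1, and later cuts only move it further right.
  closes-origin : ∀ {y} y′ → closes y ≡ true → y < y′ → y < origin y′
  closes-origin {y} (suc y′) cy y<y′ with m≤n⇒m<n∨m≡n (s≤s⁻¹ y<y′)
  ... | inj₂ refl rewrite cy = ≤-refl
  ... | inj₁ y<y″ with closes y′
  ...   | true  = y<y′
  ...   | false = closes-origin y′ cy y<y″

  light-closes : ∀ {x y} → x < y → light x y ≡ true → closes y ≡ true
  light-closes {y = y} x<y = ∃-any (λ x → light x y) (∈-upTo⁺ x<y)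

  piece⁻ : ∀ y {x} → piece y x ≡ true → origin y ≤ x × row x ≡ true
  piece⁻ y {x} h with ∧-true {does (origin y ≤? x)} h
  ... | s≤x , rx = does-true (origin y ≤? x) s≤x , rx

  light⁻ : ∀ {x y} → light x y ≡ true →
           origin y ≤ x × row x ≡ true × row y ≡ true × heavy x y ≡ false
  light⁻ {x} {y} h with ∧-true {does (origin y ≤? x)} h
  ... | s≤x , h₁ with ∧-true {row x} h₁
  ...   | rx , h₂ with ∧-true {row y} h₂
  ...     | ry , h₃ = does-true (origin y ≤? x) s≤x , rx , ry , Bool.not-injective h₃

  -- If y closes a piece, the new piece is still empty. Otherwise no light pair of the piece ends at
  -- y, so y can join it.
  piece-heavy : ∀ y {x x′} → x < x′ → x′ < y → piece y x ≡ true → piece y x′ ≡ true → heavy x x′ ≡ true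
  piece-heavy (suc y) {x} {x′} x<x′ x′<y px px′
    with s≤x , rx ← piece⁻ (suc y) px | s≤x′ , rx′ ← piece⁻ (suc y) px′
    with closes y in cy
  ... | true  = contradiction s≤x′ (<⇒≱ x′<y)
  ... | false with m≤n⇒m<n∨m≡n (s≤s⁻¹ x′<y)
  ...   | inj₁ x′<y = piece-heavy y x<x′ x′<y px px′
  ...   | inj₂ refl with heavy x y in hxy
  ...     | true  = refl
  ...     | false with () ← trans (sym cy) (light-closes x<x′
                     (cong₂ _∧_ (dec-true (origin y ≤? x) s≤x)
                       (cong₂ _∧_ rx (cong₂ _∧_ rx′ (cong not hxy)))))

  module _ (d : ℕ) (small : ∀ y → ∑ (upTo y) (⟦_⟧ ∘ piece y) < d) where

    -- Each cut accounts for a piece of fewer than d elements together with its closing element, at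
    -- most d in all. The last sum is the unfinished piece.
    size-scan : ∀ y → ∑ (upTo y) (⟦_⟧ ∘ row) ≤
                      d * ∑ (upTo y) (⟦_⟧ ∘ closes) + ∑ (upTo y) (⟦_⟧ ∘ piece y)
    size-scan zero    = z≤n
    size-scan (suc y) = begin
      ∑ (upTo (suc y)) (⟦_⟧ ∘ row)
        ≡⟨ ∑-upTo-∷ʳ _ y ⟩
      ∑ (upTo y) (⟦_⟧ ∘ row) + ⟦ row y ⟧
        ≤⟨ +-monoˡ-≤ ⟦ row y ⟧ (size-scan y) ⟩
      d * C + P + ⟦ row y ⟧
        ≤⟨ step ⟩
      d * (C + ⟦ closes y ⟧) + ∑ (upTo (suc y)) (⟦_⟧ ∘ piece (suc y))
        ≡⟨ cong (λ c → d * c + ∑ (upTo (suc y)) (⟦_⟧ ∘ piece (suc y))) (∑-upTo-∷ʳ _ y) ⟨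
      d * ∑ (upTo (suc y)) (⟦_⟧ ∘ closes) + ∑ (upTo (suc y)) (⟦_⟧ ∘ piece (suc y)) ∎
      where
      open ≤-Reasoning
      C = ∑ (upTo y) (⟦_⟧ ∘ closes)
      P = ∑ (upTo y) (⟦_⟧ ∘ piece y)
      step : d * C + P + ⟦ row y ⟧ ≤ d * (C + ⟦ closes y ⟧) + ∑ (upTo (suc y)) (⟦_⟧ ∘ piece (suc y))
      step with closes y
      ... | true = begin
        d * C + P + ⟦ row y ⟧   ≡⟨ +-assoc (d * C) P ⟦ row y ⟧ ⟩
        d * C + (P + ⟦ row y ⟧) ≤⟨ +-monoʳ-≤ (d * C) (≤-trans (+-monoʳ-≤ P (⟦⟧≤1 (row y)))
                                     (≤-trans (≤-reflexive (+-comm P 1)) (small y))) ⟩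
        d * C + d               ≡⟨ cong (d * C +_) (*-identityʳ d) ⟨
        d * C + d * 1           ≡⟨ *-distribˡ-+ d C 1 ⟨
        d * (C + 1)             ≤⟨ m≤m+n _ _ ⟩
        d * (C + 1) + _         ∎
      ... | false = begin
        d * C + P + ⟦ row y ⟧       ≤⟨ +-monoʳ-≤ (d * C + P) (⟦⟧-mono (cong₂ _∧_ (dec-true (origin y ≤? y) (origin-≤ y)))) ⟩
        d * C + P + ⟦ piece y y ⟧   ≡⟨ +-assoc (d * C) P ⟦ piece y y ⟧ ⟩
        d * C + (P + ⟦ piece y y ⟧) ≡⟨ cong₂ (λ c p → d * c + p) (sym (+-identityʳ C)) (sym (∑-upTo-∷ʳ (⟦_⟧ ∘ piece y) y)) ⟩
        d * (C + 0) + ∑ (upTo (suc y)) (⟦_⟧ ∘ piece y) ∎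

    uncut : ℕ → Bool
    uncut y = does (∑ (upTo y) (⟦_⟧ ∘ closes) ≟ 0)

    -- In a row with a cut, the unfinished piece is absorbed by doubling the coefficient d. In an
    -- uncut row it is paid for by the last term.
    size-≤ : ∀ y → ∑ (upTo y) (⟦_⟧ ∘ row) ≤ 2 * d * ∑ (upTo y) (⟦_⟧ ∘ closes) + d * ⟦ uncut y ⟧
    size-≤ y = ≤-trans (≤-trans (size-scan y) (+-monoʳ-≤ _ (<⇒≤ (small y)))) (absorb (∑ (upTo y) (⟦_⟧ ∘ closes)))
      where
      open ≤-Reasoning
      absorb : ∀ c → d * c + d ≤ 2 * d * c + d * ⟦ does (c ≟ 0) ⟧
      absorb zero    = ≤-reflexive (cong₂ _+_ (trans (*-zeroʳ d) (sym (*-zeroʳ (2 * d)))) (sym (*-identityʳ d)))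
      absorb (suc c) = begin
        d * suc c + d          ≤⟨ +-monoʳ-≤ (d * suc c) (m≤m*n d (suc c)) ⟩
        d * suc c + d * suc c  ≡⟨ double d (suc c) ⟩
        2 * d * suc c          ≤⟨ m≤m+n _ _ ⟩
        2 * d * suc c + d * 0  ∎
        where
        double : ∀ d c → d * c + d * c ≡ 2 * d * c
        double = solve-∀

    origin-uncut : ∀ y → ∑ (upTo y) (⟦_⟧ ∘ closes) ≡ 0 → origin y ≡ 0
    origin-uncut zero    _ = refl
    origin-uncut (suc y) h with closes y | trans (sym (∑-upTo-∷ʳ (⟦_⟧ ∘ closes) y)) h
    ... | true  | h′ with () ← trans (+-comm 1 (∑ (upTo y) (⟦_⟧ ∘ closes))) h′
    ... | false | h′ = origin-uncut y (m+n≡0⇒m≡0 _ h′)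

    -- Without cuts the origin stays at 0, so the whole row is one piece.
    uncut-clique : ∀ y → uncut y ≡ true → ∀ {x x′} → x < x′ → x′ < y →
                   row x ≡ true → row x′ ≡ true → heavy x x′ ≡ true
    uncut-clique y u x<x′ x′<y rx rx′ = piece-heavy y x<x′ x′<y (whole rx) (whole rx′)
      where
      whole : ∀ {x} → row x ≡ true → piece y x ≡ true
      whole {x} = cong₂ _∧_ (dec-true (origin y ≤? x)
        (subst (_≤ x) (sym (origin-uncut y (does-true (_ ≟ 0) u))) z≤n))

-- Families of distinct sets

-- The rows have to be distinct but not increasing, because the classes of `𝓜 k` leave the order of
-- rows free.
HypergraphPattern : (κ μ : Permutation′ k) → (Fin m → ℕ → Bool) → Set
HypergraphPattern {k} {m} κ μ row = ∃ λ (ρ : Fin k → Fin m) → ∃₂ λ (a b : Fin k → ℕ) →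
  Injective _≡_ _≡_ ρ × Increasing a × Increasing b × (∀ i j → a i < b j) ×
  (∀ e → row (ρ e) (a (κ ⟨$⟩ʳ e)) ≡ true × row (ρ e) (b (μ ⟨$⟩ʳ e)) ≡ true)

module Family {k m n} (κ μ : Permutation′ k) (w : Fin m → Vec Bool n)
              (w-injective : Injective _≡_ _≡_ w)
              (avoids : ¬ HypergraphPattern κ μ (at ∘ w)) where

  row : Fin m → ℕ → Bool
  row = at ∘ w

  multiplicity : ℕ → ℕ → ℕ
  multiplicity x y = ∑ (allFin m) (λ i → ⟦ row i x ∧ row i y ⟧)

  heavy : ℕ → ℕ → Bool
  heavy x y = does (k ≤? multiplicity x y)

  heavy-avoids : ¬ GraphPattern κ μ heavy
  heavy-avoids (a , b , a↑ , b↑ , a<b , h)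
    with ρ , ρ-injective , ρ-row ← distinct-representatives k
           (λ e i → row i (a (κ ⟨$⟩ʳ e)) ∧ row i (b (μ ⟨$⟩ʳ e)))
           (λ e → does-true (k ≤? multiplicity _ _) (h e))
    = avoids (ρ , a , b , ρ-injective , a↑ , b↑ , a<b , λ e → ∧-true (ρ-row e))

  -- Among 2k elements of a clique, the first k can serve as left ends and the last k as right ends
  -- of any matching.
  clique-small : ∀ (S : ℕ → Bool) y →
    (∀ {x x′} → x < x′ → x′ < y → S x ≡ true → S x′ ≡ true → heavy x x′ ≡ true) →
    ∑ (upTo y) (⟦_⟧ ∘ S) < k + k
  clique-small S y clique with k + k ≤? ∑ (upTo y) (⟦_⟧ ∘ S)
  ... | no  ≰ = ≰⇒> ≰
  ... | yes ≤ with s , s↑ , s-S ← enumerate S y (k + k) ≤ =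
    ⊥-elim (heavy-avoids (s ∘ (_↑ˡ k) , s ∘ (k ↑ʳ_) , (λ i<j → s↑ (↑ˡ-mono i<j)) , (λ i<j → s↑ (↑ʳ-mono i<j)) , (λ i j → s↑ (↑ˡ<↑ʳ i j)) ,
      λ e → clique (s↑ (↑ˡ<↑ʳ _ _)) (proj₁ (s-S _)) (proj₂ (s-S _)) (proj₂ (s-S _))))
    where
    open ≤-Reasoning
    ↑ˡ-mono : ∀ {i j : Fin k} → i Fin.< j → (i ↑ˡ k) Fin.< (j ↑ˡ k)
    ↑ˡ-mono {i} {j} = subst₂ _<_ (sym (Fin.toℕ-↑ˡ i k)) (sym (Fin.toℕ-↑ˡ j k))
    ↑ʳ-mono : ∀ {i j : Fin k} → i Fin.< j → (k ↑ʳ i) Fin.< (k ↑ʳ j)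
    ↑ʳ-mono {i} {j} i<j = subst₂ _<_ (sym (Fin.toℕ-↑ʳ k i)) (sym (Fin.toℕ-↑ʳ k j)) (+-monoʳ-< k i<j)
    ↑ˡ<↑ʳ : ∀ (i j : Fin k) → (i ↑ˡ k) Fin.< (k ↑ʳ j)
    ↑ˡ<↑ʳ i j = begin-strict
      toℕ (i ↑ˡ k) ≡⟨ Fin.toℕ-↑ˡ i k ⟩
      toℕ i        <⟨ Fin.toℕ<n i ⟩
      k            ≤⟨ m≤m+n k (toℕ j) ⟩
      k + toℕ j    ≡⟨ Fin.toℕ-↑ʳ k j ⟨
      toℕ (k ↑ʳ j) ∎

  module S (r : ℕ → Bool) = Scan heavy r

  piece-small : ∀ r y → ∑ (upTo y) (⟦_⟧ ∘ S.piece r y) < k + k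
  piece-small r y = clique-small (S.piece r y) y (S.piece-heavy r y)

  lightEdge : ℕ → ℕ → Bool
  lightEdge x y = any (λ i → S.light (row i) x y) (allFin m)

  -- Cut pairs of one row at different positions span disjoint intervals,
  -- whereas the edges of a pattern pairwise cross.
  lightEdge-avoids : ¬ GraphPattern κ μ lightEdge
  lightEdge-avoids (a , b , a↑ , b↑ , a<b , h) =
    avoids (ρ , a , b , ρ-injective , a↑ , b↑ , a<b , in-row)
    where
    chosen : ∀ e → ∃ λ i → i ∈ allFin m × S.light (row i) (a (κ ⟨$⟩ʳ e)) (b (μ ⟨$⟩ʳ e)) ≡ true
    chosen e = any-∃ _ (allFin m) (h e)
    ρ : Fin k → Fin m
    ρ e = proj₁ (chosen e)
    ρ-light : ∀ e → S.light (row (ρ e)) (a (κ ⟨$⟩ʳ e)) (b (μ ⟨$⟩ʳ e)) ≡ true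
    ρ-light e = proj₂ (proj₂ (chosen e))
    in-row : ∀ e → row (ρ e) (a (κ ⟨$⟩ʳ e)) ≡ true × row (ρ e) (b (μ ⟨$⟩ʳ e)) ≡ true
    in-row e with _ , ra , rb , _ ← S.light⁻ (row (ρ e)) {y = b (μ ⟨$⟩ʳ e)} (ρ-light e) = ra , rb
    -- If one row gave both edges, the piece cut at the later right end would start beyond the
    -- earlier right end. The left end of edge e would then exceed the right end of edge d.
    ordered : ∀ {d e} → ρ d ≡ ρ e → ¬ b (μ ⟨$⟩ʳ d) < b (μ ⟨$⟩ʳ e)
    ordered {d} {e} eq bd<be = <⇒≱ (a<b (κ ⟨$⟩ʳ e) (μ ⟨$⟩ʳ d)) (<⇒≤ (≤-trans
      (S.closes-origin (row (ρ e)) (b (μ ⟨$⟩ʳ e))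
        (S.light-closes (row (ρ e)) {y = b (μ ⟨$⟩ʳ d)} (a<b _ _)
          (subst (λ i → S.light (row i) (a (κ ⟨$⟩ʳ d)) (b (μ ⟨$⟩ʳ d)) ≡ true) eq (ρ-light d)))
        bd<be)
      (proj₁ (S.light⁻ (row (ρ e)) {y = b (μ ⟨$⟩ʳ e)} (ρ-light e)))))
    ρ-injective : Injective _≡_ _≡_ ρ
    ρ-injective {d} {e} eq with Fin.<-cmp (μ ⟨$⟩ʳ d) (μ ⟨$⟩ʳ e)
    ... | tri< d<e _ _ = contradiction (b↑ d<e) (ordered eq)
    ... | tri> _ _ e<d = contradiction (b↑ e<d) (ordered (sym eq))
    ... | tri≈ _ d≡e _ = trans (sym (inverseˡ μ)) (trans (cong (μ ⟨$⟩ˡ_) d≡e) (inverseˡ μ))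

  -- A pair at which some row is cut is not heavy, so fewer than k rows contain it at all.
  light-multiplicity : ∀ x y → ∑ (allFin m) (λ i → ⟦ S.light (row i) x y ⟧) ≤ ⟦ lightEdge x y ⟧ * k
  light-multiplicity x y with lightEdge x y in l
  ... | false = ≤-trans (∑-mono-∈ (allFin m) none) (≤-reflexive (∑-zero (allFin m)))
    where
    none : ∀ {i} → i ∈ allFin m → ⟦ S.light (row i) x y ⟧ ≤ 0
    none {i} i∈ with S.light (row i) x y in li
    ... | false = z≤n
    ... | true with () ← trans (sym l) (∃-any (λ i → S.light (row i) x y) i∈ li)
  ... | true with i , _ , li ← any-∃ _ (allFin m) l
             with _ , _ , _ , not-heavy ← S.light⁻ (row i) li = begin
    ∑ (allFin m) (λ i → ⟦ S.light (row i) x y ⟧)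
      ≤⟨ ∑-mono (allFin m) (λ i → ⟦⟧-mono (λ li → let _ , rx , ry , _ = S.light⁻ (row i) li in cong₂ _∧_ rx ry)) ⟩
    multiplicity x y
      ≤⟨ <⇒≤ (≰⇒> (does-false (k ≤? multiplicity x y) not-heavy)) ⟩
    k ≡⟨ +-identityʳ k ⟨
    1 * k ∎
    where open ≤-Reasoning

  -- A cut at y is charged to the light pairs ending there. The factor for x < y lets x range up to
  -- n independently of y, so that sums can be exchanged.
  closes-≤ : ∀ r y → y < n → ⟦ S.closes r y ⟧ ≤ ∑ (upTo n) (λ x → ⟦ does (x <? y) ⟧ * ⟦ S.light r x y ⟧)
  closes-≤ r y y<n = begin
    ⟦ S.closes r y ⟧
      ≤⟨ ∑-any (λ x → S.light r x y) (upTo y) ⟩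
    ∑ (upTo y) (λ x → ⟦ S.light r x y ⟧)
      ≤⟨ ∑-mono-∈ (upTo y) (λ {x} x∈ → ≤-reflexive (sym (trans
           (cong (λ b → ⟦ b ⟧ * ⟦ S.light r x y ⟧) (dec-true (x <? y) (∈-upTo⁻ x∈))) (+-identityʳ _)))) ⟩
    ∑ (upTo y) (λ x → ⟦ does (x <? y) ⟧ * ⟦ S.light r x y ⟧)
      ≤⟨ ∑-upTo-≤ _ (<⇒≤ y<n) ⟩
    ∑ (upTo n) (λ x → ⟦ does (x <? y) ⟧ * ⟦ S.light r x y ⟧) ∎
    where open ≤-Reasoning

  cuts : Fin m → ℕ
  cuts i = ∑ (upTo n) (⟦_⟧ ∘ S.closes (row i))

  -- Double counting: summing over pairs instead of rows, each light edge is charged at most k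
  -- times.
  cuts-bound : ∑ (allFin m) cuts ≤ count (edge lightEdge) n * k
  cuts-bound = begin
    ∑ (allFin m) cuts
      ≤⟨ ∑-mono (allFin m) (λ i → ∑-mono-∈ (upTo n) (λ {y} y∈ → closes-≤ (row i) y (∈-upTo⁻ y∈))) ⟩
    ∑ (allFin m) (λ i → ∑ (upTo n) λ y → ∑ (upTo n) λ x → L x y * ⟦ S.light (row i) x y ⟧)
      ≡⟨ ∑-swap _ (allFin m) (upTo n) ⟩
    ∑ (upTo n) (λ y → ∑ (allFin m) λ i → ∑ (upTo n) λ x → L x y * ⟦ S.light (row i) x y ⟧)
      ≡⟨ ∑-cong (upTo n) (λ y → ∑-swap _ (allFin m) (upTo n)) ⟩
    ∑ (upTo n) (λ y → ∑ (upTo n) λ x → ∑ (allFin m) λ i → L x y * ⟦ S.light (row i) x y ⟧)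
      ≡⟨ ∑-swap _ (upTo n) (upTo n) ⟩
    ∑ (upTo n) (λ x → ∑ (upTo n) λ y → ∑ (allFin m) λ i → L x y * ⟦ S.light (row i) x y ⟧)
      ≤⟨ ∑-mono (upTo n) (λ x → ∑-mono (upTo n) (cell x)) ⟩
    ∑ (upTo n) (λ x → ∑ (upTo n) λ y → ⟦ edge lightEdge x y ⟧ * k)
      ≡⟨ ∑-cong (upTo n) (λ x → ∑-*ʳ k _ (upTo n)) ⟩
    ∑ (upTo n) (λ x → ∑ (upTo n) (λ y → ⟦ edge lightEdge x y ⟧) * k)
      ≡⟨ ∑-*ʳ k _ (upTo n) ⟩
    count (edge lightEdge) n * k ∎
    where
    open ≤-Reasoning
    L : ℕ → ℕ → ℕ
    L x y = ⟦ does (x <? y) ⟧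
    ⟦∧⟧ : ∀ a b → ⟦ a ⟧ * ⟦ b ⟧ ≡ ⟦ a ∧ b ⟧
    ⟦∧⟧ true  b = +-identityʳ ⟦ b ⟧
    ⟦∧⟧ false b = refl
    cell : ∀ x y → ∑ (allFin m) (λ i → L x y * ⟦ S.light (row i) x y ⟧) ≤ ⟦ edge lightEdge x y ⟧ * k
    cell x y = begin
      ∑ (allFin m) (λ i → L x y * ⟦ S.light (row i) x y ⟧)
        ≡⟨ ∑-*ˡ (L x y) _ (allFin m) ⟩
      L x y * ∑ (allFin m) (λ i → ⟦ S.light (row i) x y ⟧)
        ≤⟨ *-monoʳ-≤ (L x y) (light-multiplicity x y) ⟩
      L x y * (⟦ lightEdge x y ⟧ * k)
        ≡⟨ *-assoc (L x y) ⟦ lightEdge x y ⟧ k ⟨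
      L x y * ⟦ lightEdge x y ⟧ * k
        ≡⟨ cong (_* k) (⟦∧⟧ (does (x <? y)) (lightEdge x y)) ⟩
      ⟦ edge lightEdge x y ⟧ * k ∎

  Uncut : Vec Bool n → Bool
  Uncut v = S.uncut (at v) (k + k) (piece-small (at v)) n

  -- The rows are distinct, so each word is counted at most once.
  uncut-bound : ∑ (allFin m) (⟦_⟧ ∘ Uncut ∘ w) ≤ ∑ (words n) (⟦_⟧ ∘ Uncut)
  uncut-bound = begin
    ∑ (allFin m) (⟦_⟧ ∘ Uncut ∘ w)
      ≡⟨ ∑-fibres w (⟦_⟧ ∘ Uncut) (allFin m) ⟩
    ∑ (words n) (λ v → ∑ (allFin m) (λ i → ⟦ does (w i ≟ʷ v) ⟧) * ⟦ Uncut v ⟧)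
      ≤⟨ ∑-mono (words n) (λ v → ≤-trans (*-monoˡ-≤ ⟦ Uncut v ⟧ (∑-allFin-≤1 _ (λ i≡ j≡ → w-injective
           (trans (does-true (_ ≟ʷ v) i≡) (sym (does-true (_ ≟ʷ v) j≡)))))) (≤-reflexive (+-identityʳ _))) ⟩
    ∑ (words n) (⟦_⟧ ∘ Uncut) ∎
    where open ≤-Reasoning

  total-bound : let c = mt-constant (suc k) in
    ∑ (allFin m) (λ i → ∑ (upTo n) (⟦_⟧ ∘ row i)) ≤
    2 * (k + k) * (c * n * k) + (k + k) * (1 + n * 2 ^ (2 * c))
  total-bound = begin
    ∑ (allFin m) (λ i → ∑ (upTo n) (⟦_⟧ ∘ row i))
      ≤⟨ ∑-mono (allFin m) (λ i → S.size-≤ (row i) (k + k) (piece-small (row i)) n) ⟩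
    ∑ (allFin m) (λ i → 2 * (k + k) * cuts i + (k + k) * ⟦ Uncut (w i) ⟧)
      ≡⟨ ∑-+ (λ i → 2 * (k + k) * cuts i) _ (allFin m) ⟩
    ∑ (allFin m) (λ i → 2 * (k + k) * cuts i) + ∑ (allFin m) (λ i → (k + k) * ⟦ Uncut (w i) ⟧)
      ≡⟨ cong₂ _+_ (∑-*ˡ (2 * (k + k)) cuts (allFin m)) (∑-*ˡ (k + k) (⟦_⟧ ∘ Uncut ∘ w) (allFin m)) ⟩
    2 * (k + k) * ∑ (allFin m) cuts + (k + k) * ∑ (allFin m) (⟦_⟧ ∘ Uncut ∘ w)
      ≤⟨ +-mono-≤
           -- Cuts are bounded by the sparsity of the light edges, uncut rows by the number of
           -- cliques of the heavy graph.
           (*-monoʳ-≤ (2 * (k + k)) (≤-trans cuts-bound (*-monoˡ-≤ k (sparse κ μ lightEdge lightEdge-avoids n))))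
           (*-monoʳ-≤ (k + k) (≤-trans uncut-bound (cliques-bound κ μ n heavy heavy-avoids Uncut
             (λ v u x<y vx vy → S.uncut-clique (at v) (k + k) (piece-small (at v)) n u x<y (at-< v vy) vx vy)))) ⟩
    2 * (k + k) * (c * n * k) + (k + k) * (1 + n * 2 ^ (2 * c)) ∎
    where
    open ≤-Reasoning
    c = mt-constant (suc k)

-- Sorting, and search through finite function spaces

minimum : ∀ (ρ : Fin (suc k) → Fin m) → ∃ λ i → ∀ j → ρ i Fin.≤ ρ j
minimum {zero}  ρ = zero , λ { zero → ≤-refl }
minimum {suc k} ρ with i , ρi≤ ← minimum (ρ ∘ suc) | Fin.≤-total (ρ zero) (ρ (suc i))
... | inj₁ ρ0≤ = zero  , λ { zero → ≤-refl ; (suc j) → ≤-trans ρ0≤ (ρi≤ j) }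
... | inj₂ ρ0≥ = suc i , λ { zero → ρ0≥    ; (suc j) → ρi≤ j }

-- Selection sort: the index of the least value comes first, and the remaining indices are sorted
-- recursively.
sort : ∀ (ρ : Fin k → Fin m) → Injective _≡_ _≡_ ρ →
       ∃ λ (σ : Permutation′ k) → ∀ {i j} → i Fin.< j → ρ (σ ⟨$⟩ʳ i) Fin.< ρ (σ ⟨$⟩ʳ j)
sort {zero}  ρ inj = id , λ { {()} }
sort {suc k} ρ inj
  with i₀ , least ← minimum ρ
  with σ , σ↑ ← sort (ρ ∘ punchIn i₀) (Fin.punchIn-injective i₀ _ _ ∘ inj) =
  insert zero i₀ σ , λ
    { {zero}  {suc j} _   → Fin.≤∧≢⇒< (least _) (Fin.punchInᵢ≢i i₀ _ ∘ sym ∘ inj)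
    ; {suc i} {suc j} i<j → σ↑ (s<s⁻¹ i<j)
    }

-- The search fixes one value at a time. A function rebuilt from its values agrees with the original
-- only pointwise, so P has to respect `_≗_`.
∃→? : ∀ {P : (Fin k → Fin n) → Set} → (∀ {f g} → f ≗ g → P f → P g) →
      (∀ f → Dec (P f)) → Dec (∃ P)
∃→? {zero}  resp P? = map′ (_ ,_) (λ (f , Pf) → resp (λ ()) Pf) (P? λ ())
∃→? {suc k} resp P? = map′
  (λ (x , f , Pxf) → (x F.∷ f) , Pxf)
  (λ (f , Pf) → f zero , f ∘ suc , resp (λ { zero → refl ; (suc i) → refl }) Pf)
  (Fin.any? λ x → ∃→? (λ f≗g → resp (λ { zero → refl ; (suc i) → f≗g i })) (λ f → P? (x F.∷ f)))

-- Matrices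

isOne : Bit → Bool
isOne zero    = false
isOne (suc _) = true

isOne⁻ : ∀ {b} → isOne b ≡ true → b ≡ 1b
isOne⁻ {suc zero} _ = refl

isOne-injective : ∀ {a b} → isOne a ≡ isOne b → a ≡ b
isOne-injective {zero}     {zero}     _ = refl
isOne-injective {suc zero} {suc zero} _ = refl

encode : Matrix m n → Fin m → Vec Bool n
encode A i = Vec.tabulate (isOne ∘ A i)

encode-injective : ∀ (A : Matrix m n) → DistinctRows A → Injective _≡_ _≡_ (encode A)
encode-injective A distinct {i} {j} eq = decidable-stable (i Fin.≟ j) λ i≢j →
  distinct i j i≢j (λ x → isOne-injective (begin
    isOne (A i x)             ≡⟨ Vec.lookup∘tabulate (isOne ∘ A i) x ⟨
    Vec.lookup (encode A i) x ≡⟨ cong (λ v → Vec.lookup v x) eq ⟩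
    Vec.lookup (encode A j) x ≡⟨ Vec.lookup∘tabulate (isOne ∘ A j) x ⟩
    isOne (A j x)             ∎))
  where open ≡-Reasoning

at-toℕ : ∀ (f : Fin n → Bool) i → at (Vec.tabulate f) (toℕ i) ≡ f i
at-toℕ f zero    = refl
at-toℕ f (suc i) = at-toℕ (f ∘ suc) i

sum-tabulate : ∀ (f : Fin n → Bit) → sumᶜ +-0-commutativeMonoid (toℕ ∘ f) ≡
               ∑ (upTo n) (⟦_⟧ ∘ at (Vec.tabulate (isOne ∘ f)))
sum-tabulate {zero}  f = refl
sum-tabulate {suc n} f = trans (cong₂ _+_ (digit (f zero)) (sum-tabulate (f ∘ suc)))
  (sym (∑-upTo-suc (⟦_⟧ ∘ at (Vec.tabulate (isOne ∘ f))) n))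
  where
  digit : ∀ b → toℕ b ≡ ⟦ isOne b ⟧
  digit zero       = refl
  digit (suc zero) = refl

sum-allFin : ∀ (f : Fin m → ℕ) → sumᶜ +-0-commutativeMonoid f ≡ ∑ (allFin m) f
sum-allFin {zero}  f = refl
sum-allFin {suc m} f = trans (cong (f zero +_) (sum-allFin (f ∘ suc))) (sym (∑-allFin-suc f))

ones-encode : ∀ (A : Matrix m n) → ones A ≡ ∑ (allFin m) (λ i → ∑ (upTo n) (⟦_⟧ ∘ at (encode A i)))
ones-encode {m} A = trans (sum-allFin (λ i → sumᶜ +-0-commutativeMonoid (toℕ ∘ A i))) (∑-cong (allFin m) (λ i → sum-tabulate (A i)))

-- Occurrences of a pattern in a matrix

module _ (A : Matrix m n) (κ μ : Permutation′ k) where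

  -- A finite, hence decidable, form of `HypergraphPattern`: s lists the columns a on its first k
  -- indices and b on its last k.
  IsOccurrence : (Fin k → Fin m) → (Fin (k + k) → Fin n) → Set
  IsOccurrence ρ s = (∀ i j → ρ i ≡ ρ j → i ≡ j) × (∀ i j → i Fin.< j → s i Fin.< s j) ×
    (∀ e → A (ρ e) (s ((κ ⟨$⟩ʳ e) ↑ˡ k)) ≡ 1b × A (ρ e) (s (k ↑ʳ (μ ⟨$⟩ʳ e))) ≡ 1b)

  isOccurrence? : ∀ ρ s → Dec (IsOccurrence ρ s)
  isOccurrence? ρ s =
    Fin.all? (λ i → Fin.all? λ j → (ρ i Fin.≟ ρ j) →-dec (i Fin.≟ j)) ×-dec
    Fin.all? (λ i → Fin.all? λ j → (i Fin.<? j) →-dec (s i Fin.<? s j)) ×-dec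
    Fin.all? (λ e → (_ Fin.≟ _) ×-dec (_ Fin.≟ _))

  IsOccurrence-resp : ∀ {ρ ρ′ s s′} → ρ ≗ ρ′ → s ≗ s′ → IsOccurrence ρ s → IsOccurrence ρ′ s′
  IsOccurrence-resp ρ≗ s≗ (inj , s↑ , h) =
    (λ i j eq → inj i j (trans (ρ≗ i) (trans eq (sym (ρ≗ j))))) ,
    (λ i j i<j → subst₂ Fin._<_ (s≗ i) (s≗ j) (s↑ i j i<j)) ,
    λ e → trans (sym (cong₂ A (ρ≗ e) (s≗ _))) (proj₁ (h e)) ,
          trans (sym (cong₂ A (ρ≗ e) (s≗ _))) (proj₂ (h e))

  -- The counting argument only refutes the absence of an occurrence; a finite search turns this
  -- into a witness.
  occurrence? : Dec (∃₂ IsOccurrence)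
  occurrence? = ∃→? (λ ρ≗ (s , occ) → s , IsOccurrence-resp ρ≗ (λ _ → refl) occ)
    (λ ρ → ∃→? (IsOccurrence-resp (λ _ → refl)) (isOccurrence? ρ))

  HypergraphPattern⇒occurrence : HypergraphPattern κ μ (at ∘ encode A) → ∃₂ IsOccurrence
  HypergraphPattern⇒occurrence (ρ , a , b , ρ-injective , a↑ , b↑ , a<b , h) =
    ρ , s , (λ i j → ρ-injective) , (λ i j → s↑) ,
    λ e → one (ρ e) (trans (toℕ-s _) (cong [ a , b ]′ (Fin.splitAt-↑ˡ k (κ ⟨$⟩ʳ e) k))) (proj₁ (h e)) ,
          one (ρ e) (trans (toℕ-s _) (cong [ a , b ]′ (Fin.splitAt-↑ʳ k k (μ ⟨$⟩ʳ e)))) (proj₂ (h e))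
    where
    t : Fin (k + k) → ℕ
    t = [ a , b ]′ ∘ Fin.splitAt k
    -- Column a i is an end of the edge numbered by the inverse image of i under κ. As `at` is
    -- `false` from n on, it lies below n.
    a< : ∀ i → a i < n
    a< i = subst (λ j → a j < n) (inverseʳ κ) (at-< (encode A _) (proj₁ (h (κ ⟨$⟩ˡ i))))
    b< : ∀ i → b i < n
    b< i = subst (λ j → b j < n) (inverseʳ μ) (at-< (encode A _) (proj₂ (h (μ ⟨$⟩ˡ i))))
    t< : ∀ i → t i < n
    t< i with Fin.splitAt k i
    ... | inj₁ x = a< x
    ... | inj₂ x = b< x
    s : Fin (k + k) → Fin n
    s i = Fin.fromℕ< (t< i)
    toℕ-s : ∀ i → toℕ (s i) ≡ t i
    toℕ-s i = Fin.toℕ-fromℕ< (t< i)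
    t↑ : ∀ {i j} → i Fin.< j → t i < t j
    t↑ {i} {j} i<j with Fin.splitAt k i in eqᵢ | Fin.splitAt k j in eqⱼ
    ... | inj₁ x | inj₁ y
      rewrite sym (Fin.splitAt⁻¹-↑ˡ eqᵢ) | sym (Fin.splitAt⁻¹-↑ˡ eqⱼ) | Fin.toℕ-↑ˡ x k | Fin.toℕ-↑ˡ y k = a↑ i<j
    ... | inj₁ x | inj₂ y = a<b x y
    ... | inj₂ x | inj₁ y
      rewrite sym (Fin.splitAt⁻¹-↑ʳ {k} eqᵢ) | sym (Fin.splitAt⁻¹-↑ˡ eqⱼ) | Fin.toℕ-↑ʳ k x | Fin.toℕ-↑ˡ y k =
      contradiction (≤-trans (m≤m+n k (toℕ x)) (<⇒≤ i<j)) (<⇒≱ (Fin.toℕ<n y))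
    ... | inj₂ x | inj₂ y
      rewrite sym (Fin.splitAt⁻¹-↑ʳ {k} eqᵢ) | sym (Fin.splitAt⁻¹-↑ʳ {k} eqⱼ) | Fin.toℕ-↑ʳ k x | Fin.toℕ-↑ʳ k y =
      b↑ (+-cancelˡ-< k _ _ i<j)
    s↑ : ∀ {i j} → i Fin.< j → s i Fin.< s j
    s↑ i<j = subst₂ _<_ (sym (toℕ-s _)) (sym (toℕ-s _)) (t↑ i<j)
    one : ∀ i {j y} → toℕ j ≡ y → at (encode A i) y ≡ true → A i j ≡ 1b
    one i {j} refl h = isOne⁻ (trans (sym (at-toℕ (isOne ∘ A i) j)) h)

-- The coefficient of n in `total-bound` once the additive 1 there is replaced by n, which is
-- positive.
constant : ℕ → ℕ
constant k = 2 * (k + k) * (mt-constant (suc k) * k) + (k + k) * (1 + 2 ^ (2 * mt-constant (suc k)))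

occurs : ∀ (A : Matrix m n) .{{_ : NonZero n}} → ones A ≥ suc (constant k) * n → DistinctRows A →
         ∀ (κ μ : Permutation′ k) → ∃₂ (IsOccurrence A κ μ)
occurs {m} {n} {k} A dense distinct κ μ = decidable-stable (occurrence? A κ μ) λ none →
  <⇒≱ (few none) dense
  where
  open ≤-Reasoning
  c = mt-constant (suc k)
  rearrange : ∀ k c n x → 2 * (k + k) * (c * n * k) + (k + k) * (n + n * x) ≡
                          (2 * (k + k) * (c * k) + (k + k) * (1 + x)) * n
  rearrange = solve-∀
  few : ¬ ∃₂ (IsOccurrence A κ μ) → ones A < suc (constant k) * n
  few none = begin-strict
    ones A
      ≡⟨ ones-encode A ⟩
    ∑ (allFin m) (λ i → ∑ (upTo n) (⟦_⟧ ∘ at (encode A i)))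
      ≤⟨ Family.total-bound κ μ (encode A) (encode-injective A distinct)
           (none ∘ HypergraphPattern⇒occurrence A κ μ) ⟩
    2 * (k + k) * (c * n * k) + (k + k) * (1 + n * 2 ^ (2 * c))
      ≤⟨ +-monoʳ-≤ (2 * (k + k) * (c * n * k)) (*-monoʳ-≤ (k + k) (+-monoˡ-≤ _ (>-nonZero⁻¹ n))) ⟩
    2 * (k + k) * (c * n * k) + (k + k) * (n + n * 2 ^ (2 * c))
      ≡⟨ rearrange k c n (2 ^ (2 * c)) ⟩
    -- Strictness comes from the extra `suc` and n > 0.
    constant k * n
      <⟨ m<n+m _ (>-nonZero⁻¹ n) ⟩
    suc (constant k) * n ∎

-- Permutation matrices and row classes

toPermutation : ∀ {P : Matrix k k} → IsPermutationMatrix P → Permutation′ k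
toPermutation (rows , cols) = permutation (proj₁ ∘ rows) (proj₁ ∘ cols)
  -- Uniqueness of the 1 in each row and column makes the two choice functions mutually inverse.
  (λ j → proj₂ (proj₂ (rows _)) (proj₁ (proj₂ (cols j))))
  (λ i → proj₂ (proj₂ (cols _)) (proj₁ (proj₂ (rows i))))

toPermutation-unique : ∀ {P : Matrix k k} (isP : IsPermutationMatrix P) {i j} → P i j ≡ 1b →
                       toPermutation isP ⟨$⟩ʳ i ≡ j
toPermutation-unique (rows , _) = proj₂ (proj₂ (rows _))

permuteRows-isPermutation : ∀ {P : Matrix k k} (σ : Permutation′ k) →
  IsPermutationMatrix P → IsPermutationMatrix (P ∘ (σ ⟨$⟩ʳ_))
permuteRows-isPermutation {P = P} σ (rows , cols) = rows ∘ (σ ⟨$⟩ʳ_) , λ j →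
  let i , Pij , unique = cols j in
  σ ⟨$⟩ˡ i , subst (λ i → P i j ≡ 1b) (sym (inverseʳ σ)) Pij ,
  λ {i′} Pσi′j → trans (cong (σ ⟨$⟩ˡ_) (unique Pσi′j)) (inverseˡ σ)

permuteRows : Permutation′ k → PermutationPair k → PermutationPair k
permuteRows σ C = record
  { K = K ∘ (σ ⟨$⟩ʳ_)
  ; L = L ∘ (σ ⟨$⟩ʳ_)
  ; K-isPermutation = permuteRows-isPermutation σ K-isPermutation
  ; L-isPermutation = permuteRows-isPermutation σ L-isPermutation
  }
  where open PermutationPair C

-- Sorting the rows of the occurrence gives a genuine sub-matrix. Applying the same σ to the rows of
-- C stays in its class.
occurrence⇒contains : ∀ (A : Matrix m n) (C : PermutationPair k) → let open PermutationPair C in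
  ∃₂ (IsOccurrence A (toPermutation K-isPermutation) (toPermutation L-isPermutation)) →
  ∃ λ σ → A Contains PermutationPair.matrix (permuteRows σ C)
occurrence⇒contains {k = k} A C (ρ , s , inj , s↑ , h) =
  σ , R , (ρ ∘ (σ ⟨$⟩ʳ_) , s , σ↑ , (λ {i} {j} → s↑ i j) , λ i j → refl) , λ i j → covers (σ ⟨$⟩ʳ i) j
  where
  open PermutationPair C using (K; L; K-isPermutation; L-isPermutation)
  sorted = sort ρ (λ {i} {j} → inj i j)
  σ = proj₁ sorted
  σ↑ = proj₂ sorted
  R : Matrix k (k + k)
  R i j = A (ρ (σ ⟨$⟩ʳ i)) (s j)
  -- Column j lies in the half of K or of L; there the 1 of row i is unique, so j is the column at
  -- which the occurrence has a 1.
  covers : ∀ i j → (K ∥ L) i j ≡ 1b → A (ρ i) (s j) ≡ 1b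
  covers i j eq with Fin.splitAt k j in split
  ... | inj₁ x = subst (λ j → A (ρ i) (s j) ≡ 1b)
        (trans (cong (_↑ˡ k) (toPermutation-unique K-isPermutation eq)) (Fin.splitAt⁻¹-↑ˡ split)) (proj₁ (h i))
  ... | inj₂ y = subst (λ j → A (ρ i) (s j) ≡ 1b)
        (trans (cong (k ↑ʳ_) (toPermutation-unique L-isPermutation eq)) (Fin.splitAt⁻¹-↑ʳ {k} split)) (proj₂ (h i))

theorem2 : (k : ℕ) .{{_ : NonZero k}} →
    ∃ λ (c : ℕ) →
    (m n : ℕ) .{{_ : NonZero m}} .{{_ : NonZero n}} (A : Matrix m n) →
    ones A ≥ c * n →
    DistinctRows A →
    let open Setoid (𝓜 k) in
    (C : Carrier) → ∃ λ (D : Carrier) → C ≈ D × A Contains matrix D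
theorem2 k = suc (constant k) , λ m n A dense distinct C →
  let open PermutationPair C
      σ , contains = occurrence⇒contains A C
        (occurs A dense distinct (toPermutation K-isPermutation) (toPermutation L-isPermutation))
  in  permuteRows σ C , (σ , λ i j → refl) , contains
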